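{- Let $G$ be a finite simple graph on $k$ vertices labeled $1,\dots,k$. Let $\mathcal{B}_{2k}$ be the set of set partitions of $[2k]=\{1,\dots,2k\}$, of size $B_{2k}$ (the Bell number), listed in some fixed order, and let $d_G$ be the tree-counting vector indexed by $\mathcal B_{2k}$ defined in the context. Then there exist a $B_{2k}\times B_{2k}$ matrix $M$ and a vector $v$ of length $B_{2k}$ (depending only on $G$) such that for all $n\ge 3$, the number of spanning trees of the Cartesian product $G\times C_n$ equals $(M^n v)\cdot d_G$, where $C_n$ is the cycle on $n$ vertices and $\cdot$ is the dot product.
   Context: The Cartesian product $G\times H$ has vertex set $V(G)\times V(H)$, with $(a,b)$ adjacent to $(a',b')$ iff either $a=a'$ and $bb'\in E(H)$, or $b=b'$ and $aa'\in E(G)$. Write vertices of $G\times P_n$ and $G\times C_n$ (same vertex set) as $(i,j)$, $i\in[k]$, $j\in[n]$; $G\times C_n$ is obtained from $G\times P_n$ by adding the $k$ edges $\{(i,1),(i,n)\}$, $i\in[k]$. For a spanning forest $\mathcal F$ of $G\times P_n$, the partition of $[2k]$ induced by $\mathcal F$ is given by $a\sim b$ iff $w_a,w_b$ lie in the same tree of $\mathcal F$, where $w_i=(i,1)$ and $w_{k+i}=(i,n)$ for $i\in[k]$. $\mathcal F$ is cylindrically consistent with a partition $P$ of $[2k]$ if $\mathcal F$ has exactly $|P|$ trees and $P$ is the partition induced by $\mathcal F$. The tree-counting vector $d_G$ has, at partition $P$, the number of subsets $S$ of the added edges $\{(i,1),(i,n)\}$, $i\in[k]$, such that adding $S$ to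 a forest cylindrically consistent with $P$ yields a spanning tree of $G\times C_n$ (this number depends only on $P$, not on $n$ or the forest). -}

module Defs where

open import Data.Bool using (Bool; true; false; if_then_else_; _∧_)
open import Data.Nat using (ℕ; zero; suc; _+_; _≤_; _<_; _<ᵇ_; z≤n; s≤s)
open import Data.Nat.Properties using (≤-trans)
open import Data.Integer using (ℤ; +_) renaming (_+_ to _+ℤ_; _*_ to _*ℤ_)
open import Data.Fin using (Fin; zero; suc; toℕ; inject₁; fromℕ<; opposite; splitAt)
open import Data.List using (List; []; _∷_; _++_; length; concatMap; map; tabulate; allFin; lookup)
open import Data.List.Properties using (length-++; length-tabulate)
open import Data.List.Membership.Propositional using (_∈_)
open import Data.List.Relation.Unary.Unique.Propositional using (Unique)
open import Data.Vec using (Vec; _[_]≔_; cast) renaming (lookup to vlookup; _++_ to _++ᵥ_)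
open import Data.Fin.Subset using (Subset)
open import Data.Product using (Σ; _×_; _,_; proj₁; proj₂; ∃)
open import Data.Sum using (_⊎_; inj₁; inj₂)
open import Relation.Nullary using (¬_)
open import Relation.Binary.PropositionalEquality using (_≡_; cong; trans)

HasCount : {A : Set} → (A → Set) → ℕ → Set
HasCount {A} P c =
  Σ (List A) λ xs → Unique xs × ((x : A) → (x ∈ xs → P x) × (P x → x ∈ xs)) × (length xs ≡ c)

-- Edge lists, edge subsets, connectivity, forests and spanning trees.
-- A (simple) graph on vertex type V is given by a list es of its edges
-- (each unordered edge listed once, as an ordered pair); a spanning
-- subgraph is a subset s of the edge list (Subset (length es) = Vec Bool).

module _ {V : Set} where

  Sel : (es : List (V × V)) → Subset (length es) → V → V → Set
  Sel es s u v = Σ (Fin (length es)) λ i → (vlookup s i ≡ true) × (lookup es i ≡ (u , v))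

  data Conn (R : V → V → Set) : V → V → Set where
    here : ∀ {u} → Conn R u u
    step : ∀ {u w v} → (R u w ⊎ R w u) → Conn R w v → Conn R u v

  Acyclic : (es : List (V × V)) → Subset (length es) → Set
  Acyclic es s = (i : Fin (length es)) → vlookup s i ≡ true →
    ¬ Conn (Sel es (s [ i ]≔ false)) (proj₁ (lookup es i)) (proj₂ (lookup es i))

  IsSpanningTree : (es : List (V × V)) → Subset (length es) → Set
  IsSpanningTree es s = ((u v : V) → Conn (Sel es s) u v) × Acyclic es s

  IsForest : (es : List (V × V)) → Subset (length es) → Set
  IsForest = Acyclic

  NumTrees : (es : List (V × V)) → Subset (length es) → ℕ → Set
  NumTrees es s c = Σ (Fin c → V) λ r →
    ((a b : Fin c) → Conn (Sel es s) (r a) (r b) → a ≡ b) ×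
    ((u : V) → ∃ λ a → Conn (Sel es s) u (r a))

record Partition (m : ℕ) : Set where
  field
    rel     : Fin m → Fin m → Bool
    rel-refl  : ∀ a → rel a a ≡ true
    rel-sym   : ∀ a b → rel a b ≡ rel b a
    rel-trans : ∀ a b c → rel a b ≡ true → rel b c ≡ true → rel a c ≡ true
open Partition public

_≈P_ : ∀ {m} → Partition m → Partition m → Set
P ≈P Q = ∀ a b → rel P a b ≡ rel Q a b

NumBlocks : ∀ {m} → Partition m → ℕ → Set
NumBlocks {m} P c = Σ (Fin c → Fin m) λ r →
  ((a b : Fin c) → rel P (r a) (r b) ≡ true → a ≡ b) ×
  ((x : Fin m) → ∃ λ a → rel P x (r a) ≡ true)

edgesG : (k : ℕ) → (Fin k → Fin k → Bool) → List (Fin k × Fin k)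
edgesG k adj = concatMap (λ i → concatMap (λ j →
  if adj i j ∧ (toℕ i <ᵇ toℕ j) then (i , j) ∷ [] else []) (allFin k)) (allFin k)

edgesPath : (n : ℕ) → List (Fin n × Fin n)
edgesPath zero = []
edgesPath (suc m) = map (λ j → (inject₁ j , suc j)) (allFin m)

edgesProd : (a b : ℕ) → List (Fin a × Fin a) → List (Fin b × Fin b) →
            List ((Fin a × Fin b) × (Fin a × Fin b))
edgesProd a b EA EB =
  concatMap (λ i → map (λ e → ((i , proj₁ e) , (i , proj₂ e))) EB) (allFin a) ++
  concatMap (λ j → map (λ e → ((proj₁ e , j) , (proj₂ e , j))) EA) (allFin b)

edgesGP : (k : ℕ) → (Fin k → Fin k → Bool) → (n : ℕ) → List ((Fin k × Fin n) × (Fin k × Fin n))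
edgesGP k adj n = edgesProd k n (edgesG k adj) (edgesPath n)

three≤⇒pos : ∀ {n} → 3 ≤ n → 0 < n
three≤⇒pos h = ≤-trans (s≤s z≤n) h

firstCol lastCol : (n : ℕ) → 0 < n → Fin n
firstCol n h = fromℕ< h
lastCol n h = opposite (fromℕ< h)

edgesWrap : (k n : ℕ) → 0 < n → List ((Fin k × Fin n) × (Fin k × Fin n))
edgesWrap k n h = tabulate (λ i → ((i , firstCol n h) , (i , lastCol n h)))

edgesGC : (k : ℕ) → (Fin k → Fin k → Bool) → (n : ℕ) → 3 ≤ n →
          List ((Fin k × Fin n) × (Fin k × Fin n))
edgesGC k adj n h = edgesGP k adj n ++ edgesWrap k n (three≤⇒pos h)

unionEdges : (k : ℕ) (adj : Fin k → Fin k → Bool) (n : ℕ) (h : 3 ≤ n) →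
             Subset (length (edgesGP k adj n)) → Subset k → Subset (length (edgesGC k adj n h))
unionEdges k adj n h F S =
  cast (trans (cong (λ x → length (edgesGP k adj n) + x) (Relation.Binary.PropositionalEquality.sym
                (length-tabulate (λ i → ((i , firstCol n (three≤⇒pos h)) , (i , lastCol n (three≤⇒pos h)))))))
              (Relation.Binary.PropositionalEquality.sym (length-++ (edgesGP k adj n))))
       (F ++ᵥ S)

wVert : (k n : ℕ) → 0 < n → Fin (k + k) → Fin k × Fin n
wVert k n h a with splitAt k a
... | inj₁ i = (i , firstCol n h)
... | inj₂ i = (i , lastCol n h)

CylConsistent : (k : ℕ) (adj : Fin k → Fin k → Bool) (n : ℕ) (h : 3 ≤ n) →
                Subset (length (edgesGP k adj n)) → Partition (k + k) → Set
CylConsistent k adj n h F P =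
  (Σ ℕ λ c → NumBlocks P c × NumTrees (edgesGP k adj n) F c) ×
  ((a b : Fin (k + k)) →
     (rel P a b ≡ true → Conn (Sel (edgesGP k adj n) F) (wVert k n (three≤⇒pos h) a) (wVert k n (three≤⇒pos h) b)) ×
     (Conn (Sel (edgesGP k adj n) F) (wVert k n (three≤⇒pos h) a) (wVert k n (three≤⇒pos h) b) → rel P a b ≡ true))

IsTreeCountingVector : (k : ℕ) (adj : Fin k → Fin k → Bool) {B : ℕ} →
                       (Fin B → Partition (k + k)) → (Fin B → ℕ) → Set
IsTreeCountingVector k adj {B} π d =
  (b : Fin B) (n : ℕ) (h : 3 ≤ n) (F : Subset (length (edgesGP k adj n))) →
  IsForest (edgesGP k adj n) F → CylConsistent k adj n h F (π b) →
  HasCount (λ (S : Subset k) → IsSpanningTree (edgesGC k adj n h) (unionEdges k adj n h F S)) (d b)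

sumFin : (B : ℕ) → (Fin B → ℤ) → ℤ
sumFin zero f = + 0
sumFin (suc B) f = f zero +ℤ sumFin B (λ i → f (suc i))

mulVec : {B : ℕ} → (Fin B → Fin B → ℤ) → (Fin B → ℤ) → Fin B → ℤ
mulVec {B} M v i = sumFin B (λ j → M i j *ℤ v j)

powVec : {B : ℕ} → (Fin B → Fin B → ℤ) → ℕ → (Fin B → ℤ) → Fin B → ℤ
powVec M zero v = v
powVec M (suc n) v = mulVec M (powVec M n v)

dot : {B : ℕ} → (Fin B → ℤ) → (Fin B → ℕ) → ℤ
dot {B} u d = sumFin B (λ b → u b *ℤ + d b)

-- The cylinder is swept column by column.  A frontier of 2k marked vertices (the
-- first column and the current one) moves over the edges of G × Pₙ one at a time,
-- each of which is taken or skipped; all that matters of the forest taken so far is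
-- the partition it induces on the frontier, or that it already fails, having closed
-- a cycle or left a component behind.  Each move is thus a linear map I + N on
-- vectors indexed by partitions, and M is the product of the moves of one column.
-- At the end a taken forest inducing P contributes d_G(P), a failed one 0.
-- Since the count uses Mⁿ and not Mⁿ⁻¹, one needs v with M v the vector of a single
-- column.  The moves of the k horizontal edges satisfy N² = 0 (a frontier vertex cut
-- off once cannot be cut off again), so they are inverted by I − N.

module Submission where

open import Defs
import Data.List.Relation.Unary.Unique.Propositional.Properties as Unique
import Data.List.Relation.Unary.All as All
import Data.Integer.Properties as ℤ
import Data.Bool as Bool
open import Data.Bool using (Bool; false; true)
open import Data.Nat using (ℕ; _+_; _≤_; zero; suc)
open import Data.Integer using (ℤ; +_; 0ℤ; 1ℤ) renaming (_+_ to _+ℤ_; _*_ to _*ℤ_; -_ to -ℤ_)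
open import Algebra.Properties.CommutativeSemigroup ℤ.+-commutativeSemigroup using (interchange)
open import Data.Fin using (Fin; zero; suc; _≟_; _↑ˡ_; _↑ʳ_; splitAt; inject₁; fromℕ)
open import Data.Fin.Subset using (Subset)
open import Data.List using (length; List; []; _∷_; _++_; map; lookup; allFin; tabulate; concatMap)
open import Data.List.Properties
  using (length-map; map-++; map-∘; map-tabulate; length-tabulate; ++-assoc; ++-identityʳ)
  renaming (length-++ to length-++-list)
open import Data.List.Membership.Propositional using (_∈_; _∉_)
open import Data.List.Membership.Propositional.Properties
  using (∈-map⁺; ∈-map⁻; ∈-++⁺ˡ; ∈-++⁺ʳ; ∈-++⁻; ∈-∃++; ∈-allFin; ∈-tabulate⁻; ∈-lookup)
open import Data.List.Relation.Unary.Any using (here; there)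
open import Data.List.Relation.Unary.All using ([]; _∷_)
open import Data.List.Relation.Unary.AllPairs using ([]; _∷_)
open import Data.List.Relation.Binary.Permutation.Propositional
  using (_↭_; prep; swap; ↭-refl; ↭-sym; ↭-trans; ↭-reflexive; module PermutationReasoning)
open import Data.List.Relation.Binary.Permutation.Propositional.Properties
  using (∈-resp-↭; ++⁺ʳ; ++⁺ˡ; drop-∷; shift; ↭-length; ¬x∷xs↭[]; ++⁺; shifts)
open import Data.List.Relation.Binary.BagAndSetEquality using (∼bag⇒↭)
open import Data.List.Membership.Propositional.Properties.WithK using (unique∧set⇒bag)
open import Data.Vec using ([]; _∷_; cast; _[_]≔_) renaming (lookup to vlookup; _++_ to _++ᵥ_)
open import Data.Vec.Properties using (cast-is-id; ∷-injectiveʳ)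
open import Data.Product using (Σ; _×_; ∃; _,_; proj₁; proj₂)
open import Data.Sum using (_⊎_; inj₁; inj₂; [_,_]′)
open import Function using (_∘_; id; mk⇔; const)
open import Relation.Nullary using (¬_; Dec; yes; no; contradiction; ¬?; _×-dec_; _⊎-dec_; does)
open import Relation.Binary.PropositionalEquality
  using (_≡_; _≢_; refl; sym; trans; cong; cong₂; subst; module ≡-Reasoning; subst₂; _≗_)
open import Relation.Nullary.Decidable using (map′; dec-true; does-⇔)
open import Relation.Binary using (IsEquivalence; DecidableEquality)
open import Data.Fin.Properties
  using (any?; all?; ↑ʳ-injective; splitAt-↑ˡ; splitAt-↑ʳ; splitAt⁻¹-↑ˡ; splitAt⁻¹-↑ʳ; suc-injective)
open import Data.Maybe using (Maybe; just; nothing; _>>=_; maybe′)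
open import Data.Vec.Functional using (updateAt)
open import Data.Vec.Functional.Properties using (updateAt-updates; updateAt-minimal)
open import Algebra.Properties.Semiring.Sum ℤ.+-*-semiring
  using (sum; sum-cong-≗; ∑-distrib-+; ∑-comm; *-distribˡ-sum; *-distribʳ-sum)
open import Data.List.Relation.Unary.Unique.Propositional using (Unique)
open import Data.Product.Properties using (≡-dec)

-- Counting by sums over sublists

-- The hypothesis on `d` speaks of actual forests of `G × Pₙ`, not of partitions, so partitions
-- alone cannot carry the argument. `transfer` therefore follows the list of taken edges together
-- with its state, weighs a finished list by the number of its completions with wrap edges, and
-- reads that weight as an entry of `d` only at the very end; entries are consulted only at
-- partitions that a forest induces. The edges of `G × Pₙ` are not listed in the order of the sweep.
-- Subsets of positions are thus traded for sublists up to permutation, and every weight has to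
-- ignore order. A failure may count as 0 only because it is irreversible. A cycle is never undone,
-- and later edges, wrap edges included, touch only frontier vertices and vertices not yet reached,
-- so a lost component is never rejoined.

hasCount-unique : {A : Set} {P : A → Set} {c c′ : ℕ} → HasCount P c → HasCount P c′ → c ≡ c′
hasCount-unique (xs , ux , mx , refl) (ys , uy , my , refl) =
  ↭-length (∼bag⇒↭ (unique∧set⇒bag ux uy λ {x} →
    mk⇔ (proj₂ (my x) ∘ proj₁ (mx x)) (proj₂ (mx x) ∘ proj₁ (my x))))

hasCount-cong : {A : Set} {P Q : A → Set} {c : ℕ} →
  (∀ x → P x → Q x) → (∀ x → Q x → P x) → HasCount P c → HasCount Q c
hasCount-cong p⇒q q⇒p (xs , u , m , l) =
  xs , u , (λ x → p⇒q x ∘ proj₁ (m x) , proj₂ (m x) ∘ q⇒p x) , l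

indicator : {P : Set} → Dec P → ℤ
indicator (yes _) = 1ℤ
indicator (no  _) = 0ℤ

indicator-cong : {P Q : Set} (p? : Dec P) (q? : Dec Q) → (P → Q) → (Q → P) →
  indicator p? ≡ indicator q?
indicator-cong (yes _) (yes _) _ _ = refl
indicator-cong (yes p) (no ¬q) f _ = contradiction (f p) ¬q
indicator-cong (no ¬p) (yes q) _ g = contradiction (g q) ¬p
indicator-cong (no _)  (no _)  _ _ = refl

indicator-no : {P : Set} (p? : Dec P) → ¬ P → indicator p? ≡ 0ℤ
indicator-no (yes p) ¬p = contradiction p ¬p
indicator-no (no _)  _  = refl

-- Chosen edges as a list rather than as positions: connectivity and cycle-freeness then become
-- predicates of lists, which transport along permutations.
pick : {E : Set} (es : List E) → Subset (length es) → List E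
pick []       []          = []
pick (e ∷ es) (true  ∷ s) = e ∷ pick es s
pick (e ∷ es) (false ∷ s) = pick es s

sumPicks : {E : Set} → List E → (List E → ℤ) → ℤ
sumPicks []       f = f []
sumPicks (e ∷ es) f = sumPicks es f +ℤ sumPicks es (f ∘ (e ∷_))

sumPicks-cong : {E : Set} (es : List E) {f g : List E → ℤ} →
  (∀ s → f (pick es s) ≡ g (pick es s)) → sumPicks es f ≡ sumPicks es g
sumPicks-cong []       f≡g = f≡g []
sumPicks-cong (e ∷ es) f≡g =
  cong₂ _+ℤ_ (sumPicks-cong es (f≡g ∘ (false ∷_))) (sumPicks-cong es (f≡g ∘ (true ∷_)))

sumPicks-zero : {E : Set} (es : List E) {f : List E → ℤ} →
  (∀ s → f (pick es s) ≡ 0ℤ) → sumPicks es f ≡ 0ℤ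
sumPicks-zero []       f≡0 = f≡0 []
sumPicks-zero (e ∷ es) f≡0 =
  cong₂ _+ℤ_ (sumPicks-zero es (f≡0 ∘ (false ∷_))) (sumPicks-zero es (f≡0 ∘ (true ∷_)))

sumPicks-++ : {E : Set} (es es′ : List E) (f : List E → ℤ) →
  sumPicks (es ++ es′) f ≡ sumPicks es (λ l → sumPicks es′ (λ l′ → f (l ++ l′)))
sumPicks-++ []       es′ f = refl
sumPicks-++ (e ∷ es) es′ f =
  cong₂ _+ℤ_ (sumPicks-++ es es′ f) (sumPicks-++ es es′ (f ∘ (e ∷_)))

-- Needed because `edgesGP` is ordered by copies of the factors and the sweep by columns.
sumPicks-↭ : {E : Set} {es es′ : List E} {f : List E → ℤ} →
  (∀ {l l′} → l ↭ l′ → f l ≡ f l′) → es ↭ es′ → sumPicks es f ≡ sumPicks es′ f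
sumPicks-↭ f-resp _↭_.refl = refl
sumPicks-↭ f-resp (prep e p) =
  cong₂ _+ℤ_ (sumPicks-↭ f-resp p) (sumPicks-↭ (f-resp ∘ prep e) p)
sumPicks-↭ {es = _ ∷ _ ∷ es} {es′ = _ ∷ _ ∷ es′} {f} f-resp (swap x y p) = begin
  (S es f +ℤ S es (f ∘ (y ∷_))) +ℤ (S es (f ∘ (x ∷_)) +ℤ S es (f ∘ (x ∷_) ∘ (y ∷_)))
    ≡⟨ interchange (S es f) _ _ _ ⟩
  (S es f +ℤ S es (f ∘ (x ∷_))) +ℤ (S es (f ∘ (y ∷_)) +ℤ S es (f ∘ (x ∷_) ∘ (y ∷_)))
    ≡⟨ cong₂ _+ℤ_ (cong₂ _+ℤ_ (sumPicks-↭ f-resp p) (sumPicks-↭ (f-resp ∘ prep x) p))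
         (cong₂ _+ℤ_ (sumPicks-↭ (f-resp ∘ prep y) p)
           -- Only the summand taking both edges sees them in exchanged order, so only here the
           -- invariance of `f` itself is used.
           (trans (sumPicks-cong es (λ s → f-resp (swap x y ↭-refl)))
                  (sumPicks-↭ (f-resp ∘ prep y ∘ prep x) p))) ⟩
  (S es′ f +ℤ S es′ (f ∘ (x ∷_))) +ℤ (S es′ (f ∘ (y ∷_)) +ℤ S es′ (f ∘ (y ∷_) ∘ (x ∷_))) ∎
  where
  open ≡-Reasoning
  S = sumPicks
sumPicks-↭ f-resp (_↭_.trans p q) = trans (sumPicks-↭ f-resp p) (sumPicks-↭ f-resp q)

hasCount-pick : {E : Set} (es : List E) {Q : List E → Set} (Q? : ∀ l → Dec (Q l)) →
  Σ ℕ λ c → HasCount (λ s → Q (pick es s)) c × + c ≡ sumPicks es (indicator ∘ Q?)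
hasCount-pick [] Q? with Q? []
... | yes q = 1 , ([] ∷ [] , [] ∷ [] , (λ { [] → (λ _ → q) , λ _ → here refl }) , refl) , refl
... | no ¬q = 0 , ([] , [] , (λ { [] → (λ ()) , λ q → contradiction q ¬q }) , refl) , refl
hasCount-pick (e ∷ es) {Q} Q?
  with hasCount-pick es Q? | hasCount-pick es (Q? ∘ (e ∷_))
... | a , (xs , ux , mx , lx) , a≡ | b , (ys , uy , my , ly) , b≡ =
  a + b , (zs , uz , mz , lz) , trans (ℤ.pos-+ a b) (cong₂ _+ℤ_ a≡ b≡)
  where
  zs = map (false ∷_) xs ++ map (true ∷_) ys

  disjoint : ∀ {s} → s ∈ map (false ∷_) xs × s ∈ map (true ∷_) ys → _
  disjoint (p , q) with ∈-map⁻ (false ∷_) p | ∈-map⁻ (true ∷_) q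
  ... | _ , _ , refl | _ , _ , ()

  uz = Unique.++⁺ (Unique.map⁺ ∷-injectiveʳ ux) (Unique.map⁺ ∷-injectiveʳ uy) disjoint

  sound : ∀ s → s ∈ zs → Q (pick (e ∷ es) s)
  sound s p with ∈-++⁻ (map (false ∷_) xs) p
  ... | inj₁ p′ with ∈-map⁻ (false ∷_) p′
  ...   | s′ , s′∈xs , refl = proj₁ (mx s′) s′∈xs
  sound s p | inj₂ p′ with ∈-map⁻ (true ∷_) p′
  ...   | s′ , s′∈ys , refl = proj₁ (my s′) s′∈ys

  complete : ∀ s → Q (pick (e ∷ es) s) → s ∈ zs
  complete (false ∷ s) q = ∈-++⁺ˡ (∈-map⁺ (false ∷_) (proj₂ (mx s) q))
  complete (true  ∷ s) q = ∈-++⁺ʳ (map (false ∷_) xs) (∈-map⁺ (true ∷_) (proj₂ (my s) q))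

  mz = λ s → sound s , complete s

  lz : length zs ≡ a + b
  lz = trans (length-++-list (map (false ∷_) xs))
             (cong₂ _+_ (trans (length-map (false ∷_) xs) lx) (trans (length-map (true ∷_) ys) ly))

hasCount-pick-cast : {E : Set} {m : ℕ} (es : List E) (eq : m ≡ length es)
  {Q : List E → Set} (Q? : ∀ l → Dec (Q l)) →
  Σ ℕ λ c → HasCount (λ (s : Subset m) → Q (pick es (cast eq s))) c × + c ≡ sumPicks es (indicator ∘ Q?)
hasCount-pick-cast es refl {Q} Q? with hasCount-pick es Q?
... | c , hc , c≡ = c , hasCount-cong (λ s → subst (Q ∘ pick es) (sym (cast-is-id refl s)))
                                      (λ s → subst (Q ∘ pick es) (cast-is-id refl s)) hc , c≡

pick-++ : {E : Set} {m : ℕ} (es es′ : List E) .(eq : length es + m ≡ length (es ++ es′))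
  .(eq′ : m ≡ length es′) (s : Subset (length es)) (s′ : Subset m) →
  pick (es ++ es′) (cast eq (s ++ᵥ s′)) ≡ pick es s ++ pick es′ (cast eq′ s′)
pick-++ []       es′ eq eq′ []          s′ = refl
pick-++ (e ∷ es) es′ eq eq′ (true  ∷ s) s′ = cong (e ∷_) (pick-++ es es′ _ eq′ s s′)
pick-++ (e ∷ es) es′ eq eq′ (false ∷ s) s′ = pick-++ es es′ _ eq′ s s′

-- Turns a choice made in sweep order into a subset of `edgesGP`, which is what the hypothesis on
-- `d` quantifies over.
pick-↭ : {E : Set} {es es′ : List E} → es ↭ es′ → ∀ s → ∃ λ s′ → pick es s ↭ pick es′ s′
pick-↭ _↭_.refl s = s , ↭-refl
pick-↭ (prep e p) (true ∷ s) with pick-↭ p s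
... | s′ , q = true ∷ s′ , prep e q
pick-↭ (prep e p) (false ∷ s) with pick-↭ p s
... | s′ , q = false ∷ s′ , q
pick-↭ (swap x y p) (b ∷ b′ ∷ s) with pick-↭ p s
pick-↭ (swap x y p) (true  ∷ true  ∷ s) | s′ , q = true  ∷ true  ∷ s′ , swap x y q
pick-↭ (swap x y p) (true  ∷ false ∷ s) | s′ , q = false ∷ true  ∷ s′ , prep x q
pick-↭ (swap x y p) (false ∷ true  ∷ s) | s′ , q = true  ∷ false ∷ s′ , prep y q
pick-↭ (swap x y p) (false ∷ false ∷ s) | s′ , q = false ∷ false ∷ s′ , q
pick-↭ (_↭_.trans p q) s with pick-↭ p s
... | s′ , r with pick-↭ q s′
...   | s″ , r′ = s″ , ↭-trans r r′

pick⊆ : {E : Set} (es : List E) (s : Subset (length es)) {e : E} → e ∈ pick es s →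
  ∃ λ i → vlookup s i ≡ true × lookup es i ≡ e
pick⊆ []       []          ()
pick⊆ (_ ∷ es) (true  ∷ s) (here refl) = zero , refl , refl
pick⊆ (_ ∷ es) (true  ∷ s) (there p) with pick⊆ es s p
... | i , si , ei = suc i , si , ei
pick⊆ (_ ∷ es) (false ∷ s) p with pick⊆ es s p
... | i , si , ei = suc i , si , ei

-- Clearing a bit removes a single occurrence. This links the deletions in `Acyclic` to the
-- reorderings in `CycleFree`.
pick-remove : {E : Set} (es : List E) (s : Subset (length es)) (i : Fin (length es)) →
  vlookup s i ≡ true → pick es s ↭ lookup es i ∷ pick es (s [ i ]≔ false)
pick-remove (e ∷ es) (true  ∷ s) zero    refl = ↭-refl
pick-remove (e ∷ es) (true  ∷ s) (suc i) si   =
  ↭-trans (prep e (pick-remove es s i si)) (swap e (lookup es i) ↭-refl)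
pick-remove (e ∷ es) (false ∷ s) (suc i) si   = pick-remove es s i si

-- Paths and cycles

-- The equivalence generated by an equivalence _~_ and the pair (x, y).
Join : {V : Set} → (V → V → Set) → V → V → V → V → Set
Join _~_ x y u v = u ~ v ⊎ (u ~ x × y ~ v) ⊎ (u ~ y × x ~ v)

pattern direct p     = inj₁ p
pattern forwards p q  = inj₂ (inj₁ (p , q))
pattern backwards p q = inj₂ (inj₂ (p , q))

join-map : {V : Set} (R R′ : V → V → Set) → (∀ u v → R u v → R′ u v) →
  ∀ {x y u v} → Join R x y u v → Join R′ x y u v
join-map _ _ f (direct p)      = direct (f _ _ p)
join-map _ _ f (forwards p q)  = forwards (f _ _ p) (f _ _ q)
join-map _ _ f (backwards p q) = backwards (f _ _ p) (f _ _ q)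

-- If both factors of a composition use the new pair, two uses in the same direction shorten to one,
-- keeping the outer halves, and two in opposite directions cancel.
join-equivalence : {V : Set} {_~_ : V → V → Set} → IsEquivalence _~_ → (x y : V) →
  IsEquivalence (Join _~_ x y)
join-equivalence {_~_ = _~_} eq x y = record { refl = direct ~refl ; sym = join-sym ; trans = join-trans }
  where
  open IsEquivalence eq using () renaming (refl to ~refl; sym to ~sym; trans to ~trans)

  join-sym : ∀ {u v} → Join _~_ x y u v → Join _~_ x y v u
  join-sym (direct p)      = direct (~sym p)
  join-sym (forwards p q)  = backwards (~sym q) (~sym p)
  join-sym (backwards p q) = forwards (~sym q) (~sym p)

  join-trans : ∀ {u v w} → Join _~_ x y u v → Join _~_ x y v w → Join _~_ x y u w
  join-trans (direct p)      (direct q)       = direct (~trans p q)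
  join-trans (direct p)      (forwards q r)   = forwards (~trans p q) r
  join-trans (direct p)      (backwards q r)  = backwards (~trans p q) r
  join-trans (forwards p q)  (direct r)       = forwards p (~trans q r)
  join-trans (forwards p q)  (forwards r s)   = forwards p s
  join-trans (forwards p q)  (backwards r s)  = direct (~trans p s)
  join-trans (backwards p q) (direct r)       = backwards p (~trans q r)
  join-trans (backwards p q) (forwards r s)   = direct (~trans p s)
  join-trans (backwards p q) (backwards r s)  = backwards p s

conn-trans : {V : Set} {R : V → V → Set} {u v w : V} → Conn R u v → Conn R v w → Conn R u w
conn-trans here       q = q
conn-trans (step r p) q = step r (conn-trans p q)

conn-sym : {V : Set} {R : V → V → Set} {u v : V} → Conn R u v → Conn R v u
conn-sym here              = here
conn-sym (step (inj₁ r) p) = conn-trans (conn-sym p) (step (inj₂ r) here)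
conn-sym (step (inj₂ r) p) = conn-trans (conn-sym p) (step (inj₁ r) here)

conn-equivalence : {V : Set} {R : V → V → Set} → IsEquivalence (Conn R)
conn-equivalence = record { refl = here ; sym = conn-sym ; trans = conn-trans }

-- The universal property of the generated equivalence. Applied to `Join`, it gives `path-∷⁻`
-- without tracking how often a path crosses the new edge.
conn-least : {V : Set} {R _~_ : V → V → Set} → IsEquivalence _~_ →
  (∀ {u v} → R u v → u ~ v) → ∀ {u v} → Conn R u v → u ~ v
conn-least {R = R} {_~_} eq R⇒~ = go
  where
  open IsEquivalence eq using () renaming (refl to ~refl; sym to ~sym; trans to ~trans)

  go : ∀ {u v} → Conn R u v → u ~ v
  go here              = ~refl
  go (step (inj₁ r) p) = ~trans (R⇒~ r) (go p)
  go (step (inj₂ r) p) = ~trans (~sym (R⇒~ r)) (go p)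

conn-map : {V : Set} {R R′ : V → V → Set} → (∀ {u v} → R u v → R′ u v) →
  ∀ {u v} → Conn R u v → Conn R′ u v
conn-map f here              = here
conn-map f (step (inj₁ r) p) = step (inj₁ (f r)) (conn-map f p)
conn-map f (step (inj₂ r) p) = step (inj₂ (f r)) (conn-map f p)

Path : {V : Set} → List (V × V) → V → V → Set
Path l = Conn (λ u v → (u , v) ∈ l)

path-mono : {V : Set} {l l′ : List (V × V)} → (∀ {e} → e ∈ l → e ∈ l′) → ∀ {u v} → Path l u v → Path l′ u v
path-mono l⊆l′ = conn-map l⊆l′

path-there : {V : Set} {e : V × V} {l : List (V × V)} {u v : V} → Path l u v → Path (e ∷ l) u v
path-there = path-mono there

path-edge : {V : Set} {l : List (V × V)} {u v : V} → (u , v) ∈ l → Path l u v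
path-edge e∈l = step (inj₁ e∈l) here

path-↭ : {V : Set} {l l′ : List (V × V)} → l ↭ l′ → ∀ {u v} → Path l u v → Path l′ u v
path-↭ p = path-mono (∈-resp-↭ p)

path-∷⁻ : {V : Set} {l : List (V × V)} {x y u v : V} → Path ((x , y) ∷ l) u v → Join (Path l) x y u v
path-∷⁻ {x = x} {y} = conn-least (join-equivalence conn-equivalence x y)
  λ { (here refl) → forwards here here ; (there p) → direct (path-edge p) }

path-∷⁺ : {V : Set} {l : List (V × V)} {x y u v : V} → Join (Path l) x y u v → Path ((x , y) ∷ l) u v
path-∷⁺ (direct p)      = path-there p
path-∷⁺ (forwards p q)  = conn-trans (path-there p) (step (inj₁ (here refl)) (path-there q))
path-∷⁺ (backwards p q) = conn-trans (path-there p) (step (inj₂ (here refl)) (path-there q))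

-- Recursion on the edges instead of a search for paths: one edge more is a `Join`, a finite
-- combination of questions about the remaining list.
path? : {V : Set} → DecidableEquality V → (l : List (V × V)) (u v : V) → Dec (Path l u v)
path? _≟_ [] u v = map′ (λ { refl → here }) (λ { here → refl ; (step (inj₁ ()) _) ; (step (inj₂ ()) _) }) (u ≟ v)
path? _≟_ ((x , y) ∷ l) u v = map′ path-∷⁺ path-∷⁻
  (path? _≟_ l u v ⊎-dec (path? _≟_ l u x ×-dec path? _≟_ l y v)
                   ⊎-dec (path? _≟_ l u y ×-dec path? _≟_ l x v))

-- Phrased over all reorderings so that invariance under permutation is immediate.
CycleFree : {V : Set} → List (V × V) → Set
CycleFree l = ∀ x y l′ → l ↭ (x , y) ∷ l′ → ¬ Path l′ x y

cycleFree-↭ : {V : Set} {l l′ : List (V × V)} → l ↭ l′ → CycleFree l → CycleFree l′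
cycleFree-↭ p cf x y l′ q = cf x y l′ (↭-trans p q)

cycleFree-tail : {V : Set} {e : V × V} {l : List (V × V)} → CycleFree (e ∷ l) → CycleFree l
cycleFree-tail {e = e} cf x y l′ p q =
  cf x y (e ∷ l′) (↭-trans (prep e p) (swap e (x , y) ↭-refl)) (path-there q)

-- Any new cycle runs through the new edge. If it was found at another edge `(x′ , y′)`, rotating it
-- exhibits a path in `l` between `x` and `y`.
cycleFree-∷ : {V : Set} {x y : V} {l : List (V × V)} → ¬ Path l x y → CycleFree l → CycleFree ((x , y) ∷ l)
cycleFree-∷ {x = x} {y} {l} x≁y cf x′ y′ l′ p q with ∈-resp-↭ (↭-sym p) (here refl)
... | here refl = x≁y (path-↭ (↭-sym (drop-∷ p)) q)
... | there e′∈l with ∈-∃++ e′∈l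
...   | as , bs , refl = absurd (path-∷⁻ (path-↭ (drop-∷ (↭-sym p″)) q))
  where
  l″ = as ++ bs

  p′ : as ++ (x′ , y′) ∷ bs ↭ (x′ , y′) ∷ l″
  p′ = shift (x′ , y′) as bs

  p″ : (x′ , y′) ∷ (x , y) ∷ l″ ↭ (x′ , y′) ∷ l′
  p″ = ↭-trans (swap (x′ , y′) (x , y) ↭-refl) (↭-trans (prep (x , y) (↭-sym p′)) p)

  lift : ∀ {u v} → Path l″ u v → Path l u v
  lift r = path-↭ (↭-sym p′) (path-there r)

  e′ : Path l x′ y′
  e′ = path-edge e′∈l

  absurd : ¬ Join (Path l″) x y x′ y′
  absurd (direct r)      = cf x′ y′ l″ p′ r
  absurd (forwards r s)  = x≁y (conn-trans (conn-sym (lift r)) (conn-trans e′ (conn-sym (lift s))))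
  absurd (backwards r s) = x≁y (conn-trans (lift s) (conn-trans (conn-sym e′) (lift r)))

cycleFree-++ˡ : {V : Set} {F S : List (V × V)} → CycleFree (F ++ S) → CycleFree F
cycleFree-++ˡ {S = S} cf x y l′ p q =
  cf x y (l′ ++ S) (++⁺ʳ S p) (path-mono ∈-++⁺ˡ q)

cycleFree? : {V : Set} → DecidableEquality V → (l : List (V × V)) → Dec (CycleFree l)
cycleFree? _≟_ [] = yes λ _ _ _ p → contradiction (↭-sym p) ¬x∷xs↭[]
cycleFree? _≟_ ((x , y) ∷ l) = map′
  (λ (x≁y , cf) → cycleFree-∷ x≁y cf) (λ cf → cf x y l ↭-refl , cycleFree-tail cf)
  (¬? (path? _≟_ l x y) ×-dec cycleFree? _≟_ l)

sel⇒path : {V : Set} (es : List (V × V)) (s : Subset (length es)) {u v : V} →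
  Conn (Sel es s) u v → Path (pick es s) u v
sel⇒path es s = conn-map λ { (i , si , refl) →
  ∈-resp-↭ (↭-sym (pick-remove es s i si)) (here refl) }

path⇒sel : {V : Set} (es : List (V × V)) (s : Subset (length es)) {u v : V} →
  Path (pick es s) u v → Conn (Sel es s) u v
path⇒sel es s = conn-map (pick⊆ es s)

acyclic⇒cycleFree : {V : Set} (es : List (V × V)) (s : Subset (length es)) →
  Acyclic es s → CycleFree (pick es s)
acyclic⇒cycleFree es s ac x y l′ p q with pick⊆ es s (∈-resp-↭ (↭-sym p) (here refl))
... | i , si , refl = ac i si
  (path⇒sel es _ (path-↭ (drop-∷ (↭-trans (↭-sym p) (pick-remove es s i si))) q))

cycleFree⇒acyclic : {V : Set} (es : List (V × V)) (s : Subset (length es)) →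
  CycleFree (pick es s) → Acyclic es s
cycleFree⇒acyclic es s cf i si q = cf _ _ _ (pick-remove es s i si) (sel⇒path es _ q)

IsTree : {V : Set} → List (V × V) → Set
IsTree l = (∀ u v → Path l u v) × CycleFree l

isTree-↭ : {V : Set} {l l′ : List (V × V)} → l ↭ l′ → IsTree l → IsTree l′
isTree-↭ p (conn , cf) = (λ u v → path-↭ p (conn u v)) , cycleFree-↭ p cf

spanningTree⇒isTree : {V : Set} (es : List (V × V)) (s : Subset (length es)) →
  IsSpanningTree es s → IsTree (pick es s)
spanningTree⇒isTree es s (conn , ac) =
  (λ u v → sel⇒path es s (conn u v)) , acyclic⇒cycleFree es s ac

isTree⇒spanningTree : {V : Set} (es : List (V × V)) (s : Subset (length es)) →
  IsTree (pick es s) → IsSpanningTree es s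
isTree⇒spanningTree es s (conn , cf) =
  (λ u v → path⇒sel es s (conn u v)) , cycleFree⇒acyclic es s cf

-- Sweeping a frontier over a graph

Same : {m : ℕ} → Partition m → Fin m → Fin m → Set
Same P a b = rel P a b ≡ true

same? : {m : ℕ} (P : Partition m) (a b : Fin m) → Dec (Same P a b)
same? P a b = rel P a b Bool.≟ true

same-equivalence : {m : ℕ} (P : Partition m) → IsEquivalence (Same P)
same-equivalence P = record
  { refl  = rel-refl P _
  ; sym   = λ {a} {b} p → trans (rel-sym P b a) p
  ; trans = λ {a} {b} {c} → rel-trans P a b c
  }

does-true⁻ : {P : Set} (p? : Dec P) → does p? ≡ true → P
does-true⁻ (yes p) _ = p

module _ {m : ℕ} {R : Fin m → Fin m → Set} (R? : ∀ a b → Dec (R a b)) (eq : IsEquivalence R) where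
  open IsEquivalence eq using () renaming (refl to R-refl; sym to R-sym; trans to R-trans)

  classes : Partition m
  classes = record
    { rel       = λ a b → does (R? a b)
    ; rel-refl  = λ a → dec-true (R? a a) R-refl
    ; rel-sym   = λ a b → does-⇔ (mk⇔ R-sym R-sym) (R? a b) (R? b a)
    ; rel-trans = λ a b c p q →
        dec-true (R? a c) (R-trans (does-true⁻ (R? a b) p) (does-true⁻ (R? b c) q))
    }

-- What the frontier sees once mark `a` has moved to an isolated vertex: `a` becomes a singleton and
-- the other marks keep their relations.
Detach : {V : Set} → (V → V → Set) → V → V → V → Set
Detach _~_ a u v = u ≡ v ⊎ (u ≢ a × v ≢ a × u ~ v)

detach-equivalence : {V : Set} {_~_ : V → V → Set} → IsEquivalence _~_ → (a : V) →
  IsEquivalence (Detach _~_ a)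
detach-equivalence eq a = record
  { refl  = inj₁ refl
  ; sym   = λ { (inj₁ refl) → inj₁ refl ; (inj₂ (p , q , r)) → inj₂ (q , p , ~sym r) }
  ; trans = λ { (inj₁ refl) q → q ; p@(inj₂ _) (inj₁ refl) → p
              ; (inj₂ (p , _ , r)) (inj₂ (_ , q , s)) → inj₂ (p , q , ~trans r s) }
  }
  where open IsEquivalence eq using () renaming (sym to ~sym; trans to ~trans)

-- A frontier of m marked vertices is swept over a graph, and at each step one
-- edge of the graph is either taken or skipped: link a b concerns the edge
-- between the marked vertices a and b, advance a the edge from the marked
-- vertex a to a new vertex, which becomes the marked vertex a.
data Op (m : ℕ) : Set where
  link    : Fin m → Fin m → Op m
  advance : Fin m → Op m

-- `active` holds the vertices reached so far. Only among these can a component count as lost, since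
-- every other vertex is still waiting to be reached.
record Config (m : ℕ) (V : Set) : Set where
  constructor _,_
  field
    mark   : Fin m → V
    active : List V

data Step {m : ℕ} {V : Set} : Config m V → Op m × (V × V) → Config m V → Set where
  link    : ∀ {t A a b x y} → t a ≡ x → t b ≡ y → Step (t , A) (link a b , x , y) (t , A)
  advance : ∀ {t A a x y} → t a ≡ x → y ∉ A →
            Step (t , A) (advance a , x , y) (updateAt t a (const y) , y ∷ A)

data Run {m : ℕ} {V : Set} : Config m V → List (Op m × (V × V)) → Config m V → Set where
  []  : ∀ {Γ} → Run Γ [] Γ
  _∷_ : ∀ {Γ Δ Ξ o os} → Step Γ o Δ → Run Δ os Ξ → Run Γ (o ∷ os) Ξ

run-++ : ∀ {m V} {Γ Δ Ξ : Config m V} {os os′} → Run Γ os Δ → Run Δ os′ Ξ → Run Γ (os ++ os′) Ξ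
run-++ []       r′ = r′
run-++ (s ∷ r) r′ = s ∷ run-++ r r′

-- This invariant makes a vertex outside `active` isolated in `F`, so the effect of an `advance` can
-- be read off the partition.
Supported : ∀ {m V} → Config m V → List (V × V) → Set
Supported (t , A) F = (∀ {x y} → (x , y) ∈ F → x ∈ A × y ∈ A) × (∀ a → t a ∈ A)

path-active : {V : Set} {F : List (V × V)} {A : List V} →
  (∀ {x y} → (x , y) ∈ F → x ∈ A × y ∈ A) → ∀ {u v} → Path F u v → u ∈ A → v ∈ A
path-active sup here              u∈A = u∈A
path-active sup (step (inj₁ e) p) u∈A = path-active sup p (proj₂ (sup e))
path-active sup (step (inj₂ e) p) u∈A = path-active sup p (proj₁ (sup e))

step-skip-supported : ∀ {m V} {Γ Δ : Config m V} {o e F} → Step Γ (o , e) Δ → Supported Γ F → Supported Δ F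
step-skip-supported (link _ _) sup = sup
step-skip-supported {Γ = t , A} (advance {a = a} {y = y} refl y∉A) (sup , t∈A) =
  (λ e → there (proj₁ (sup e)) , there (proj₂ (sup e))) , t′∈A
  where
  t′∈A : ∀ c → updateAt t a (const y) c ∈ y ∷ A
  t′∈A c with c ≟ a
  ... | yes refl = here (updateAt-updates a t)
  ... | no c≢a   = there (subst (_∈ A) (sym (updateAt-minimal c a t c≢a)) (t∈A c))

step-take-supported : ∀ {m V} {Γ Δ : Config m V} {o e F} → Step Γ (o , e) Δ → Supported Γ F → Supported Δ (e ∷ F)
step-take-supported {F = F} s sup with step-skip-supported s sup
step-take-supported (link {a = a} {b} refl refl) _ | sup′ , t∈A =
  (λ { (here refl) → t∈A a , t∈A b ; (there p) → sup′ p }) , t∈A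
step-take-supported (advance {a = a} refl _) (_ , t∈A) | sup′ , t′∈A =
  (λ { (here refl) → there (t∈A a) , here refl ; (there p) → sup′ p }) , t′∈A

-- States of the frontier and their transitions

module _ {m B : ℕ} (π : Fin B → Partition m) (complete : ∀ P → ∃ λ b → π b ≈P P) where

  index : {R : Fin m → Fin m → Set} → (∀ a b → Dec (R a b)) → IsEquivalence R → Fin B
  index R? eq = proj₁ (complete (classes R? eq))

  module _ {R : Fin m → Fin m → Set} (R? : ∀ a b → Dec (R a b)) (eq : IsEquivalence R) where

    index⁻ : ∀ {c d} → Same (π (index R? eq)) c d → R c d
    index⁻ {c} {d} p = does-true⁻ (R? c d) (trans (sym (proj₂ (complete (classes R? eq)) c d)) p)

    index⁺ : ∀ {c d} → R c d → Same (π (index R? eq)) c d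
    index⁺ {c} {d} r = trans (proj₂ (complete (classes R? eq)) c d) (dec-true (R? c d) r)

  join? : ∀ β a b c d → Dec (Join (Same (π β)) a b c d)
  join? β a b c d = same? (π β) c d ⊎-dec (same? (π β) c a ×-dec same? (π β) b d)
                                    ⊎-dec (same? (π β) c b ×-dec same? (π β) a d)

  detach? : ∀ β a c d → Dec (Detach (Same (π β)) a c d)
  detach? β a c d = c ≟ d ⊎-dec (¬? (c ≟ a) ×-dec ¬? (d ≟ a) ×-dec same? (π β) c d)

  -- The condition under which mark `a` may leave without its component being lost: another mark,
  -- possibly on the same vertex, remains in it.
  Accompanied : Fin B → Fin m → Set
  Accompanied β a = ∃ λ c → c ≢ a × Same (π β) a c

  accompanied? : ∀ β a → Dec (Accompanied β a)
  accompanied? β a = any? λ c → ¬? (c ≟ a) ×-dec same? (π β) a c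

  join-eq : ∀ β a b → IsEquivalence (Join (Same (π β)) a b)
  join-eq β = join-equivalence (same-equivalence (π β))

  detach-eq : ∀ β a → IsEquivalence (Detach (Same (π β)) a)
  detach-eq β = detach-equivalence (same-equivalence (π β))

  -- The effect of taking the edge of link a b and of skipping that of advance a;
  -- the other choice leaves the partition unchanged.  The result is nothing when
  -- a cycle is closed or a component is cut off from the frontier.
  act : Op m → Fin B → Maybe (Fin B)
  act (link a b) β with same? (π β) a b
  ... | yes _ = nothing
  ... | no _  = just (index (join? β a b) (join-eq β a b))
  act (advance a) β with accompanied? β a
  ... | yes _ = just (index (detach? β a) (detach-eq β a))
  ... | no _  = nothing

  act-advance² : ∀ a β → (act (advance a) β >>= act (advance a)) ≡ nothing
  act-advance² a β with accompanied? β a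
  ... | no _ = refl
  ... | yes _ with accompanied? (index (detach? β a) (detach-eq β a)) a
  ...   | no _ = refl
  ...   | yes (c , c≢a , p) with index⁻ (detach? β a) (detach-eq β a) p
  ...     | inj₁ a≡c           = contradiction (sym a≡c) c≢a
  ...     | inj₂ (a≢a , _ , _) = contradiction refl a≢a

  -- A taken `advance` keeps the partition because the new vertex hangs from the old one and
  -- inherits its block; so here, unlike for `link`, taking is the trivial choice.
  skip take : Op m → Maybe (Fin B) → Maybe (Fin B)
  skip (link _ _)    q = q
  skip o@(advance _) q = q >>= act o
  take o@(link _ _)  q = q >>= act o
  take (advance _)   q = q

  -- In a live state every active component meets the frontier, so blocks correspond to components.
  -- A failed state records a defect that persists under all later steps.
  Describes : {V : Set} → Config m V → List (V × V) → Maybe (Fin B) → Set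
  Describes (t , A) F (just β) =
    CycleFree F ×
    (∀ c d → Same (π β) c d → Path F (t c) (t d)) × (∀ c d → Path F (t c) (t d) → Same (π β) c d) ×
    (∀ u → u ∈ A → ∃ λ c → Path F u (t c))
  Describes (t , A) F nothing =
    ¬ CycleFree F ⊎ ∃ λ u → u ∈ A × ∀ c → ¬ Path F u (t c)

  step-skip-describes : {V : Set} {Γ Δ : Config m V} {o : Op m} {e : V × V} {F : List (V × V)} →
    Step Γ (o , e) Δ → Supported Γ F → ∀ q → Describes Γ F q → Describes Δ F (skip o q)
  step-skip-describes (link _ _) _ q D = D
  step-skip-describes {F = F} (advance {t} {A} {a} {_} {y} refl y∉A) (sup , t∈A) q D = go q D
    where
    t′ = updateAt t a (const y)

    at-a : t′ a ≡ y
    at-a = updateAt-updates a t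

    off-a : ∀ {c} → c ≢ a → t′ c ≡ t c
    off-a {c} = updateAt-minimal c a t

    isolated : ∀ {u} → u ∈ A → ¬ Path F u y
    isolated u∈A p = y∉A (path-active sup p u∈A)

    lost : ∀ {u} → u ∈ A → (∀ c → c ≢ a → ¬ Path F u (t c)) → ∀ c → ¬ Path F u (t′ c)
    lost u∈A dead c p with c ≟ a
    ... | yes refl = isolated u∈A (subst (Path F _) at-a p)
    ... | no c≢a   = dead c c≢a (subst (Path F _) (off-a c≢a) p)

    go : ∀ q → Describes (t , A) F q → Describes (t′ , y ∷ A) F (skip (advance a) q)
    go nothing (inj₁ cyc) = inj₁ cyc
    go nothing (inj₂ (u , u∈A , dead)) = inj₂ (u , there u∈A , lost u∈A (λ c _ → dead c))
    go (just β) (cf , S⇒P , P⇒S , alive) with accompanied? β a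
    -- The vertex just left is the lost one: no other mark is joined to it, and mark `a` now sits on
    -- an isolated vertex.
    ... | no alone = inj₂ (t a , there (t∈A a) , lost (t∈A a) λ c c≢a p → alone (c , c≢a , P⇒S a c p))
    ... | yes (c′ , c′≢a , a~c′) = cf , to , from , alive′
      where
      D? = detach? β a
      Deq = detach-eq β a

      to : ∀ c d → Same (π (index D? Deq)) c d → Path F (t′ c) (t′ d)
      to c d p with index⁻ D? Deq p
      ... | inj₁ refl = here
      ... | inj₂ (c≢a , d≢a , r) = subst₂ (Path F) (sym (off-a c≢a)) (sym (off-a d≢a)) (S⇒P c d r)

      from : ∀ c d → Path F (t′ c) (t′ d) → Same (π (index D? Deq)) c d
      from c d p with c ≟ a | d ≟ a
      ... | yes refl | yes refl = index⁺ D? Deq (inj₁ refl)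
      ... | yes refl | no d≢a   =
        contradiction (conn-sym (subst₂ (Path F) at-a (off-a d≢a) p)) (isolated (t∈A d))
      ... | no c≢a   | yes refl = contradiction (subst₂ (Path F) (off-a c≢a) at-a p) (isolated (t∈A c))
      ... | no c≢a   | no d≢a   =
        index⁺ D? Deq (inj₂ (c≢a , d≢a , P⇒S c d (subst₂ (Path F) (off-a c≢a) (off-a d≢a) p)))

      alive′ : ∀ u → u ∈ y ∷ A → ∃ λ c → Path F u (t′ c)
      alive′ u (here refl) = a , subst (Path F u) (sym at-a) here
      alive′ u (there u∈A) with alive u u∈A
      ... | c , p with c ≟ a
      ...   | no c≢a   = c , subst (Path F u) (sym (off-a c≢a)) p
      -- A component that was seen through `a` is now seen through its companion `c′`.
      ...   | yes refl =
        c′ , subst (Path F u) (sym (off-a c′≢a)) (conn-trans p (S⇒P a c′ a~c′))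

  -- A taken `link` merges two blocks, or closes a cycle within one. A taken `advance` adds `y` as a
  -- pendant vertex: paths between old active vertices stay the same (`restrict`), and each mark
  -- stays in its component (`old~new`).
  step-take-describes : {V : Set} {Γ Δ : Config m V} {o : Op m} {e : V × V} {F : List (V × V)} →
    Step Γ (o , e) Δ → Supported Γ F → ∀ q → Describes Γ F q → Describes Δ (e ∷ F) (take o q)
  step-take-describes {F = F} (link {t} {A} {a} {b} refl refl) _ q D = go q D
    where
    F′ = (t a , t b) ∷ F

    go : ∀ q → Describes (t , A) F q → Describes (t , A) F′ (take (link a b) q)
    go nothing (inj₁ cyc) = inj₁ (cyc ∘ cycleFree-tail)
    go nothing (inj₂ (u , u∈A , dead)) = inj₂ (u , u∈A , λ c p → lost c (path-∷⁻ p))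
      where
      -- A path through the new edge reaches a mark before crossing it, so the lost vertex would
      -- have been joined to a mark already.
      lost : ∀ c → ¬ Join (Path F) (t a) (t b) u (t c)
      lost c (direct p)      = dead c p
      lost c (forwards p _)  = dead a p
      lost c (backwards p _) = dead b p
    go (just β) (cf , S⇒P , P⇒S , alive) with same? (π β) a b
    ... | yes a~b = inj₁ λ cf′ → cf′ _ _ _ ↭-refl (S⇒P a b a~b)
    ... | no a≁b =
      cycleFree-∷ (a≁b ∘ P⇒S a b) cf ,
      (λ c d p → path-∷⁺ (join-map (Same (π β)) P S⇒P (index⁻ J? Jeq p))) ,
      (λ c d p → index⁺ J? Jeq (join-map P (Same (π β)) P⇒S (path-∷⁻ p))) ,
      λ u u∈A → proj₁ (alive u u∈A) , path-there (proj₂ (alive u u∈A))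
      where
      J? = join? β a b
      Jeq = join-eq β a b
      P = λ c d → Path F (t c) (t d)
  step-take-describes {F = F} (advance {t} {A} {a} {_} {y} refl y∉A) (sup , t∈A) q D = go q D
    where
    t′ = updateAt t a (const y)
    F′ = (t a , y) ∷ F

    isolated : ∀ {u} → u ∈ A → ¬ Path F u y
    isolated u∈A p = y∉A (path-active sup p u∈A)

    restrict : ∀ {u v} → u ∈ A → v ∈ A → Path F′ u v → Path F u v
    restrict u∈A v∈A p with path-∷⁻ p
    ... | direct q      = q
    ... | forwards _ q  = contradiction (conn-sym q) (isolated v∈A)
    ... | backwards q _ = contradiction q (isolated u∈A)

    old~new : ∀ c → Path F′ (t c) (t′ c)
    old~new c with c ≟ a
    ... | yes refl = subst (Path F′ (t c)) (sym (updateAt-updates a t)) (path-edge (here refl))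
    ... | no c≢a   = subst (Path F′ (t c)) (sym (updateAt-minimal c a t c≢a)) here

    go : ∀ q → Describes (t , A) F q → Describes (t′ , y ∷ A) F′ q
    go nothing (inj₁ cyc) = inj₁ (cyc ∘ cycleFree-tail)
    go nothing (inj₂ (u , u∈A , dead)) = inj₂ (u , there u∈A , λ c p →
      dead c (restrict u∈A (t∈A c) (conn-trans p (conn-sym (old~new c)))))
    go (just β) (cf , S⇒P , P⇒S , alive) =
      cycleFree-∷ (isolated (t∈A a)) cf ,
      (λ c d p → conn-trans (conn-sym (old~new c)) (conn-trans (path-there (S⇒P c d p)) (old~new d))) ,
      (λ c d p → P⇒S c d (restrict (t∈A c) (t∈A d)
        (conn-trans (old~new c) (conn-trans p (conn-sym (old~new d)))))) ,
      alive′
      where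
      alive′ : ∀ u → u ∈ y ∷ A → ∃ λ c → Path F′ u (t′ c)
      alive′ u (here refl) = a , subst (Path F′ u) (sym (updateAt-updates a t)) here
      alive′ u (there u∈A) with alive u u∈A
      ... | c , p = c , conn-trans (path-there p) (old~new c)

-- Transfer matrices

Vector Matrix : ℕ → Set
Vector B = Fin B → ℤ
Matrix B = Fin B → Fin B → ℤ

sumFin≡sum : (B : ℕ) (f : Vector B) → sumFin B f ≡ sum f
sumFin≡sum zero    f = refl
sumFin≡sum (suc B) f = cong (f zero +ℤ_) (sumFin≡sum B (f ∘ suc))

sumFin-cong : {B : ℕ} {f g : Vector B} → f ≗ g → sumFin B f ≡ sumFin B g
sumFin-cong {B} {f} {g} f≗g = trans (sumFin≡sum B f) (trans (sum-cong-≗ f≗g) (sym (sumFin≡sum B g)))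

sumFin-+ : {B : ℕ} (f g : Vector B) → sumFin B (λ i → f i +ℤ g i) ≡ sumFin B f +ℤ sumFin B g
sumFin-+ {B} f g = trans (sumFin≡sum B _)
  (trans (∑-distrib-+ f g) (sym (cong₂ _+ℤ_ (sumFin≡sum B f) (sumFin≡sum B g))))

sumFin-*ˡ : {B : ℕ} (x : ℤ) (f : Vector B) → x *ℤ sumFin B f ≡ sumFin B (λ i → x *ℤ f i)
sumFin-*ˡ {B} x f = trans (cong (x *ℤ_) (sumFin≡sum B f)) (trans (*-distribˡ-sum x f) (sym (sumFin≡sum B _)))

sumFin-*ʳ : {B : ℕ} (x : ℤ) (f : Vector B) → sumFin B f *ℤ x ≡ sumFin B (λ i → f i *ℤ x)
sumFin-*ʳ {B} x f = trans (cong (_*ℤ x) (sumFin≡sum B f)) (trans (*-distribʳ-sum x f) (sym (sumFin≡sum B _)))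

sumFin-swap : {B C : ℕ} (f : Fin B → Fin C → ℤ) →
  sumFin B (λ i → sumFin C (f i)) ≡ sumFin C (λ j → sumFin B (λ i → f i j))
sumFin-swap {B} {C} f = begin
  sumFin B (λ i → sumFin C (f i))           ≡⟨ sumFin-cong (λ i → sumFin≡sum C (f i)) ⟩
  sumFin B (λ i → sum (f i))                ≡⟨ sumFin≡sum B _ ⟩
  sum (λ i → sum (f i))                     ≡⟨ ∑-comm f ⟩
  sum (λ j → sum (λ i → f i j))             ≡⟨ sumFin≡sum C _ ⟨
  sumFin C (λ j → sum (λ i → f i j))        ≡⟨ sumFin-cong (λ j → sumFin≡sum B (λ i → f i j)) ⟨
  sumFin C (λ j → sumFin B (λ i → f i j))   ∎
  where open ≡-Reasoning

mulVec-cong : {B : ℕ} (M : Matrix B) {v w : Vector B} → v ≗ w → mulVec M v ≗ mulVec M w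
mulVec-cong M v≗w i = sumFin-cong λ j → cong (M i j *ℤ_) (v≗w j)

mulVec-+ : {B : ℕ} (M : Matrix B) (v w : Vector B) (i : Fin B) →
  mulVec M (λ j → v j +ℤ w j) i ≡ mulVec M v i +ℤ mulVec M w i
mulVec-+ M v w i = trans (sumFin-cong λ j → ℤ.*-distribˡ-+ (M i j) (v j) (w j)) (sumFin-+ (λ j → M i j *ℤ v j) (λ j → M i j *ℤ w j))

infixr 7 _⊗_

_⊗_ : {B : ℕ} → Matrix B → Matrix B → Matrix B
(M ⊗ N) i j = mulVec M (λ l → N l j) i

mulVec-⊗ : {B : ℕ} (M N : Matrix B) (v : Vector B) → mulVec (M ⊗ N) v ≗ mulVec M (mulVec N v)
mulVec-⊗ {B} M N v i = begin
  sumFin B (λ j → sumFin B (λ l → M i l *ℤ N l j) *ℤ v j)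
    ≡⟨ sumFin-cong (λ j → sumFin-*ʳ (v j) (λ l → M i l *ℤ N l j)) ⟩
  sumFin B (λ j → sumFin B (λ l → M i l *ℤ N l j *ℤ v j))
    ≡⟨ sumFin-swap (λ j l → M i l *ℤ N l j *ℤ v j) ⟩
  sumFin B (λ l → sumFin B (λ j → M i l *ℤ N l j *ℤ v j))
    ≡⟨ sumFin-cong (λ l → sumFin-cong λ j → ℤ.*-assoc (M i l) (N l j) (v j)) ⟩
  sumFin B (λ l → sumFin B (λ j → M i l *ℤ (N l j *ℤ v j)))
    ≡⟨ sumFin-cong (λ l → sumFin-*ˡ (M i l) (λ j → N l j *ℤ v j)) ⟨
  sumFin B (λ l → M i l *ℤ mulVec N v l) ∎
  where open ≡-Reasoning

powVec-suc : {B : ℕ} (M : Matrix B) (n : ℕ) (v : Vector B) → powVec M (suc n) v ≗ powVec M n (mulVec M v)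
powVec-suc M zero    v i = refl
powVec-suc M (suc n) v i = mulVec-cong M (powVec-suc M n v) i

-- The identity matrix; its row `b` doubles as the basis vector at `b`.
unit : {B : ℕ} → Matrix B
unit zero    zero    = 1ℤ
unit zero    (suc _) = 0ℤ
unit (suc _) zero    = 0ℤ
unit (suc i) (suc j) = unit i j

sumFin-zero : {B : ℕ} (f : Vector B) → (∀ i → f i ≡ 0ℤ) → sumFin B f ≡ 0ℤ
sumFin-zero {zero}  f f≡0 = refl
sumFin-zero {suc B} f f≡0 = cong₂ _+ℤ_ (f≡0 zero) (sumFin-zero (f ∘ suc) (f≡0 ∘ suc))

sumFin-unit : {B : ℕ} (f : Vector B) (b : Fin B) → sumFin B (λ i → f i *ℤ unit b i) ≡ f b
sumFin-unit {suc B} f zero = trans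
  (cong₂ _+ℤ_ (ℤ.*-identityʳ (f zero)) (sumFin-zero _ λ i → ℤ.*-zeroʳ (f (suc i))))
  (ℤ.+-identityʳ (f zero))
sumFin-unit {suc B} f (suc b) = trans
  (cong₂ _+ℤ_ (ℤ.*-zeroʳ (f zero)) (sumFin-unit (f ∘ suc) b))
  (ℤ.+-identityˡ (f (suc b)))

-- Failure is the zero vector, so linear maps preserve it and it adds nothing to a dot product.
point : {B : ℕ} → Maybe (Fin B) → Vector B
point (just b) = unit b
point nothing  = const 0ℤ

sumFin-point : {B : ℕ} (f : Vector B) (q : Maybe (Fin B)) → sumFin B (λ i → f i *ℤ point q i) ≡ maybe′ f 0ℤ q
sumFin-point f (just b) = sumFin-unit f b
sumFin-point f nothing  = sumFin-zero _ λ i → ℤ.*-zeroʳ (f i)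

mulVec-unit : {B : ℕ} (v : Vector B) → mulVec unit v ≗ v
mulVec-unit v i = trans (sumFin-cong λ j → ℤ.*-comm (unit i j) (v j)) (sumFin-unit v i)

dot-cong : {B : ℕ} {u v : Vector B} (d : Fin B → ℕ) → u ≗ v → dot u d ≡ dot v d
dot-cong d u≗v = sumFin-cong λ b → cong (_*ℤ + d b) (u≗v b)

dot-+ : {B : ℕ} (u v : Vector B) (d : Fin B → ℕ) → dot (λ b → u b +ℤ v b) d ≡ dot u d +ℤ dot v d
dot-+ u v d = trans (sumFin-cong λ b → ℤ.*-distribʳ-+ (+ d b) (u b) (v b)) (sumFin-+ (λ b → u b *ℤ + d b) (λ b → v b *ℤ + d b))

dot-point : {B : ℕ} (q : Maybe (Fin B)) (d : Fin B → ℕ) → dot (point q) d ≡ maybe′ (+_ ∘ d) 0ℤ q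
dot-point q d = trans (sumFin-cong λ b → ℤ.*-comm (point q b) (+ d b)) (sumFin-point (+_ ∘ d) q)

-- The linear extension of a partial map: column `j` is the image of the basis vector at `j`.
graph : {B : ℕ} → (Fin B → Maybe (Fin B)) → Matrix B
graph f i j = point (f j) i

maybe-point : {B : ℕ} (f : Fin B → Maybe (Fin B)) (q : Maybe (Fin B)) (i : Fin B) →
  maybe′ (λ j → point (f j) i) 0ℤ q ≡ point (q >>= f) i
maybe-point f (just _) i = refl
maybe-point f nothing  i = refl

mulVec-graph : {B : ℕ} (f : Fin B → Maybe (Fin B)) (q : Maybe (Fin B)) →
  mulVec (graph f) (point q) ≗ point (q >>= f)
mulVec-graph f q i = trans (sumFin-point (λ j → point (f j) i) q) (maybe-point f q i)

-- Column `j` of the squared matrix is `point (f j >>= f)`, hence zero.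
graph-nilpotent : {B : ℕ} (f : Fin B → Maybe (Fin B)) → (∀ b → (f b >>= f) ≡ nothing) →
  (v : Vector B) (i : Fin B) → mulVec (graph f) (mulVec (graph f) v) i ≡ 0ℤ
graph-nilpotent f f² v i = trans (sym (mulVec-⊗ (graph f) (graph f) v i))
  (sumFin-zero _ λ j → cong (_*ℤ v j) (trans (mulVec-graph f (f j) i) (cong (λ q → point q i) (f² j))))

id+graph : {B : ℕ} → (Fin B → Maybe (Fin B)) → Matrix B
id+graph f i j = unit i j +ℤ graph f i j

mulVec-id+graph : {B : ℕ} (f : Fin B → Maybe (Fin B)) (v : Vector B) (i : Fin B) →
  mulVec (id+graph f) v i ≡ v i +ℤ mulVec (graph f) v i
mulVec-id+graph f v i = begin
  mulVec (id+graph f) v i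
    ≡⟨ sumFin-cong (λ j → ℤ.*-distribʳ-+ (v j) (unit i j) (graph f i j)) ⟩
  sumFin _ (λ j → unit i j *ℤ v j +ℤ graph f i j *ℤ v j)
    ≡⟨ sumFin-+ (λ j → unit i j *ℤ v j) (λ j → graph f i j *ℤ v j) ⟩
  mulVec unit v i +ℤ mulVec (graph f) v i
    ≡⟨ cong (_+ℤ mulVec (graph f) v i) (mulVec-unit v i) ⟩
  v i +ℤ mulVec (graph f) v i ∎
  where open ≡-Reasoning

id-graph : {B : ℕ} → (Fin B → Maybe (Fin B)) → Vector B → Vector B
id-graph f v i = v i +ℤ -ℤ mulVec (graph f) v i

id+graph-inverse : {B : ℕ} (f : Fin B → Maybe (Fin B)) → (∀ b → (f b >>= f) ≡ nothing) →
  (v : Vector B) → mulVec (id+graph f) (id-graph f v) ≗ v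
id+graph-inverse f f² v i = begin
  mulVec (id+graph f) w i   ≡⟨ mulVec-id+graph f w i ⟩
  w i +ℤ mulVec N w i       ≡⟨ cong (w i +ℤ_) Nw≡Nv ⟩
  w i +ℤ mulVec N v i       ≡⟨ w+Nv i ⟩
  v i                       ∎
  where
  open ≡-Reasoning
  N = graph f
  w = id-graph f v

  w+Nv : ∀ j → w j +ℤ mulVec N v j ≡ v j
  w+Nv j = begin
    (v j +ℤ -ℤ mulVec N v j) +ℤ mulVec N v j ≡⟨ ℤ.+-assoc (v j) _ _ ⟩
    v j +ℤ (-ℤ mulVec N v j +ℤ mulVec N v j) ≡⟨ cong (v j +ℤ_) (ℤ.+-inverseˡ (mulVec N v j)) ⟩
    v j +ℤ 0ℤ                                ≡⟨ ℤ.+-identityʳ (v j) ⟩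
    v j                                      ∎

  -- As `w + N v` is `v`, adding the vanishing term `N (N v)` to `N w` produces `N v`.
  Nw≡Nv : mulVec N w i ≡ mulVec N v i
  Nw≡Nv = begin
    mulVec N w i                               ≡⟨ ℤ.+-identityʳ _ ⟨
    mulVec N w i +ℤ 0ℤ                         ≡⟨ cong (mulVec N w i +ℤ_) (graph-nilpotent f f² v i) ⟨
    mulVec N w i +ℤ mulVec N (mulVec N v) i    ≡⟨ mulVec-+ N w (mulVec N v) i ⟨
    mulVec N (λ j → w j +ℤ mulVec N v j) i     ≡⟨ mulVec-cong N w+Nv i ⟩
    mulVec N v i                               ∎

-- Matrices of operations and the transfer principle

module _ {m B : ℕ} (π : Fin B → Partition m) (complete : ∀ P → ∃ λ b → π b ≈P P) where

  opMatrix : Op m → Matrix B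
  opMatrix o = id+graph (act π complete o)

  runMatrix : List (Op m) → Matrix B
  runMatrix []       = unit
  runMatrix (o ∷ os) = runMatrix os ⊗ opMatrix o

  runMatrix-++ : ∀ os os′ v →
    mulVec (runMatrix (os ++ os′)) v ≗ mulVec (runMatrix os′) (mulVec (runMatrix os) v)
  runMatrix-++ [] os′ v i = mulVec-cong (runMatrix os′) (λ j → sym (mulVec-unit v j)) i
  runMatrix-++ (o ∷ os) os′ v i = begin
    mulVec (runMatrix (os ++ os′) ⊗ opMatrix o) v i
      ≡⟨ mulVec-⊗ (runMatrix (os ++ os′)) (opMatrix o) v i ⟩
    mulVec (runMatrix (os ++ os′)) (mulVec (opMatrix o) v) i
      ≡⟨ runMatrix-++ os os′ _ i ⟩
    mulVec (runMatrix os′) (mulVec (runMatrix os) (mulVec (opMatrix o) v)) i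
      ≡⟨ mulVec-cong (runMatrix os′) (mulVec-⊗ (runMatrix os) (opMatrix o) v) i ⟨
    mulVec (runMatrix os′) (mulVec (runMatrix os ⊗ opMatrix o) v) i ∎
    where open ≡-Reasoning

  -- The first operation is the rightmost factor of `runMatrix`, hence the leftmost, applied last,
  -- in the inverse.
  undoAdvances : List (Fin m) → Vector B → Vector B
  undoAdvances []       v = v
  undoAdvances (a ∷ as) v = id-graph (act π complete (advance a)) (undoAdvances as v)

  runMatrix-advances : ∀ as v → mulVec (runMatrix (map advance as)) (undoAdvances as v) ≗ v
  runMatrix-advances []       v i = mulVec-unit v i
  runMatrix-advances (a ∷ as) v i = begin
    mulVec (runMatrix (map advance as) ⊗ opMatrix (advance a)) w i
      ≡⟨ mulVec-⊗ (runMatrix (map advance as)) (opMatrix (advance a)) w i ⟩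
    mulVec (runMatrix (map advance as)) (mulVec (opMatrix (advance a)) w) i
      ≡⟨ mulVec-cong (runMatrix (map advance as))
           (id+graph-inverse (act π complete (advance a)) (act-advance² π complete a) _) i ⟩
    mulVec (runMatrix (map advance as)) (undoAdvances as v) i
      ≡⟨ runMatrix-advances as v i ⟩
    v i ∎
    where
    open ≡-Reasoning
    w = undoAdvances (a ∷ as) v

  opMatrix-point : ∀ o q i →
    mulVec (opMatrix o) (point q) i ≡ point (skip π complete o q) i +ℤ point (take π complete o q) i
  opMatrix-point o q i = trans (mulVec-id+graph (act π complete o) (point q) i)
    (trans (cong (point q i +ℤ_) (mulVec-graph (act π complete o) q i)) (split o))
    where
    split : ∀ o → point q i +ℤ point (q >>= act π complete o) i ≡
                  point (skip π complete o q) i +ℤ point (take π complete o q) i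
    split (link _ _)    = refl
    -- For an `advance` the identity summand stands for the taken edge, so the two terms trade
    -- places.
    split o@(advance _) = ℤ.+-comm (point q i) (point (q >>= act π complete o) i)

  -- The sum over choices and the matrix of an operation both split into a skipped and a taken part,
  -- and linearity matches them edge by edge. Through `final`, the weight of a finished list depends
  -- only on its state. Taken edges pile up in `F` newest first, so `g` must ignore order.
  transfer : {V : Set} {g : List (V × V) → ℤ} → (∀ {l l′} → l ↭ l′ → g l ≡ g l′) → (d : Fin B → ℕ) →
    ∀ {Γ Δ os F} → Run Γ os Δ →
    (∀ s {F′} q → F′ ↭ pick (map proj₂ os) s ++ F → Supported Δ F′ → Describes π complete Δ F′ q →
       g F′ ≡ dot (point q) d) →
    ∀ q → Supported Γ F → Describes π complete Γ F q →
    sumPicks (map proj₂ os) (λ l → g (l ++ F)) ≡ dot (mulVec (runMatrix (map proj₁ os)) (point q)) d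
  transfer g-resp d [] final q sup D =
    trans (final [] q ↭-refl sup D) (dot-cong d λ i → sym (mulVec-unit (point q) i))
  transfer {g = g} g-resp d {os = (o , e) ∷ os} {F} (st ∷ run) final q sup D = begin
    sumPicks es (λ l → g (l ++ F)) +ℤ sumPicks es (λ l → g (e ∷ l ++ F))
      ≡⟨ cong (sumPicks es (λ l → g (l ++ F)) +ℤ_)
           (sumPicks-cong es λ s → g-resp (↭-sym (shift e (pick es s) F))) ⟩
    sumPicks es (λ l → g (l ++ F)) +ℤ sumPicks es (λ l → g (l ++ e ∷ F))
      ≡⟨ cong₂ _+ℤ_
           (transfer g-resp d run (final ∘ (false ∷_)) q₀
             (step-skip-supported st sup) (step-skip-describes π complete st sup q D))
           (transfer g-resp d run
             (λ s q′ p → final (true Data.Vec.∷ s) q′ (↭-trans p (shift e (pick es s) F))) q₁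
             (step-take-supported st sup) (step-take-describes π complete st sup q D)) ⟩
    dot (mulVec R (point q₀)) d +ℤ dot (mulVec R (point q₁)) d
      ≡⟨ dot-+ (mulVec R (point q₀)) (mulVec R (point q₁)) d ⟨
    dot (λ i → mulVec R (point q₀) i +ℤ mulVec R (point q₁) i) d
      ≡⟨ dot-cong d (λ i → begin
           mulVec R (point q₀) i +ℤ mulVec R (point q₁) i   ≡⟨ mulVec-+ R _ _ i ⟨
           mulVec R (λ j → point q₀ j +ℤ point q₁ j) i      ≡⟨ mulVec-cong R (opMatrix-point o q) i ⟨
           mulVec R (mulVec (opMatrix o) (point q)) i       ≡⟨ mulVec-⊗ R (opMatrix o) (point q) i ⟨
           mulVec (R ⊗ opMatrix o) (point q) i              ∎) ⟩
    dot (mulVec (R ⊗ opMatrix o) (point q)) d ∎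
    where
    open ≡-Reasoning
    es = map proj₂ os
    R = runMatrix (map proj₁ os)
    q₀ = skip π complete o q
    q₁ = take π complete o q

-- The cylinder

-- Supplies the block representatives for `CylConsistent`; carried over by the marks, they also
-- represent the trees.
numBlocks : {m : ℕ} (P : Partition m) → ∃ (NumBlocks P)
numBlocks {zero}  P = 0 , (λ ()) , (λ ()) , λ ()
numBlocks {suc m} P = extend (numBlocks P′)
  where
  P′ : Partition m
  P′ = record
    { rel       = λ a b → rel P (suc a) (suc b)
    ; rel-refl  = λ a → rel-refl P (suc a)
    ; rel-sym   = λ a b → rel-sym P (suc a) (suc b)
    ; rel-trans = λ a b c → rel-trans P (suc a) (suc b) (suc c)
    }

  extend : ∃ (NumBlocks P′) → ∃ (NumBlocks P)
  extend (c , r , r-inj , r-cov) with any? (λ a → same? P zero (suc (r a)))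
  ... | yes a₀ = c , suc ∘ r , r-inj , λ { zero → a₀ ; (suc x) → r-cov x }
  ... | no new = suc c , r′ , r′-inj , λ { zero → zero , rel-refl P zero
                                         ; (suc x) → suc (proj₁ (r-cov x)) , proj₂ (r-cov x) }
    where
    r′ : Fin (suc c) → Fin (suc m)
    r′ zero    = zero
    r′ (suc a) = suc (r a)

    r′-inj : ∀ a b → Same P (r′ a) (r′ b) → a ≡ b
    r′-inj zero    zero    _ = refl
    r′-inj zero    (suc b) p = contradiction (b , p) new
    r′-inj (suc a) zero    p = contradiction (a , trans (rel-sym P zero (suc (r a))) p) new
    r′-inj (suc a) (suc b) p = cong suc (r-inj a b p)

-- Splits the first edge off every row at once, which turns an order by rows into an order by
-- columns.
concatMap-∷ : {A B : Set} (f : A → B) (g : A → List B) (xs : List A) →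
  concatMap (λ x → f x ∷ g x) xs ↭ map f xs ++ concatMap g xs
concatMap-∷ f g []       = ↭-refl
concatMap-∷ f g (x ∷ xs) = prep (f x)
  (↭-trans (++⁺ˡ (g x) (concatMap-∷ f g xs)) (shifts (g x) (map f xs)))

↑ˡ≢↑ʳ : ∀ k (i j : Fin k) → i ↑ˡ k ≢ k ↑ʳ j
↑ˡ≢↑ʳ k i j eq with trans (sym (splitAt-↑ˡ k i k)) (trans (cong (splitAt k) eq) (splitAt-↑ʳ k k j))
... | ()

-- The edges of the path product in sweep order

Edge : ℕ → Set → Set
Edge k C = (Fin k × C) × (Fin k × C)

along : ∀ {k C} → C × C → Fin k → Edge k C
along p i = (i , proj₁ p) , (i , proj₂ p)

across : ∀ {k C} → C → Fin k × Fin k → Edge k C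
across y e = (proj₁ e , y) , (proj₂ e , y)

rowOp : ∀ {k C} → C × C → Fin k → Op (k + k) × Edge k C
rowOp {k} p i = advance (k ↑ʳ i) , along p i

colOp : ∀ {k C} → C → Fin k × Fin k → Op (k + k) × Edge k C
colOp {k} y e = link (k ↑ʳ proj₁ e) (k ↑ʳ proj₂ e) , across y e

-- Columns are named through a function `c`, so the recursion can shift to `c ∘ suc` while the
-- vertex type stays fixed.
sweep : ∀ {k C} → List (Fin k × Fin k) → (m : ℕ) → (Fin (suc m) → C) → List (Op (k + k) × Edge k C)
sweep     es zero    c = []
sweep {k} es (suc m) c =
  map (rowOp (c zero , c (suc zero))) (allFin k) ++ map (colOp (c (suc zero))) es ++ sweep es m (c ∘ suc)

fullSweep : ∀ {k C} → List (Fin k × Fin k) → (m : ℕ) → (Fin (suc m) → C) → List (Op (k + k) × Edge k C)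
fullSweep es m c = map (colOp (c zero)) es ++ sweep es m c

pathPairs : ∀ {C : Set} m → (Fin (suc m) → C) → List (C × C)
pathPairs m c = tabulate λ j → c (inject₁ j) , c (suc j)

-- The sweep alternates between horizontal edges and copies of `G`, whereas `edgesProd` lists all
-- horizontal edges first. Each step moves one copy of `G` past the remaining rows. The copy in the
-- first column belongs to `fullSweep`.
sweep-edges : ∀ {k C} (es : List (Fin k × Fin k)) m (c : Fin (suc m) → C) →
  map proj₂ (sweep es m c) ↭
  concatMap (λ i → map (λ p → along p i) (pathPairs m c)) (allFin k) ++
  concatMap (λ y → map (across y) es) (tabulate (c ∘ suc))
sweep-edges {k} es zero c = ↭-reflexive (sym (trans (++-identityʳ _) (empty (allFin k))))
  where
  empty : ∀ xs → concatMap (λ i → map (λ p → along p i) (pathPairs zero c)) xs ≡ []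
  empty []       = refl
  empty (_ ∷ xs) = empty xs
sweep-edges {k} es (suc m) c = begin
  map proj₂ (map (rowOp p₀) (allFin k) ++ map (colOp y) es ++ sweep es m (c ∘ suc))
    ≡⟨ trans (map-++ proj₂ (map (rowOp p₀) (allFin k)) _)
         (cong₂ _++_ (sym (map-∘ (allFin k)))
           (trans (map-++ proj₂ (map (colOp y) es) _) (cong (_++ map proj₂ (sweep es m (c ∘ suc))) (sym (map-∘ es))))) ⟩
  hs ++ ks ++ map proj₂ (sweep es m (c ∘ suc))
    ↭⟨ ++⁺ˡ hs (++⁺ˡ ks (sweep-edges es m (c ∘ suc))) ⟩
  hs ++ ks ++ rows ++ cols
    ↭⟨ ++⁺ˡ hs (shifts ks rows) ⟩
  hs ++ rows ++ ks ++ cols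
    ≡⟨ ++-assoc hs rows (ks ++ cols) ⟨
  (hs ++ rows) ++ ks ++ cols
    ↭⟨ ++⁺ʳ (ks ++ cols) (concatMap-∷ (along p₀) (λ i → map (λ p → along p i) (pathPairs m (c ∘ suc))) (allFin k)) ⟨
  concatMap (λ i → map (λ p → along p i) (pathPairs (suc m) c)) (allFin k) ++ ks ++ cols ∎
  where
  open PermutationReasoning
  y = c (suc zero)
  p₀ = c zero , y
  hs = map (along p₀) (allFin k)
  ks = map (across y) es
  rows = concatMap (λ i → map (λ p → along p i) (pathPairs m (c ∘ suc))) (allFin k)
  cols = concatMap (λ y′ → map (across y′) es) (tabulate λ j → c (suc (suc j)))

fullSweep-edges : ∀ k adj m → map proj₂ (fullSweep (edgesG k adj) m id) ↭ edgesGP k adj (suc m)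
fullSweep-edges k adj m = begin
  map proj₂ (map (colOp zero) es ++ sweep es m id)
    ≡⟨ trans (map-++ proj₂ (map (colOp zero) es) _)
         (cong (_++ map proj₂ (sweep es m id)) (sym (map-∘ es))) ⟩
  map (across zero) es ++ map proj₂ (sweep es m id)
    ↭⟨ ++⁺ˡ (map (across zero) es) (sweep-edges es m id) ⟩
  map (across zero) es ++ rows (pathPairs m id) ++ cols
    ↭⟨ shifts (map (across zero) es) (rows (pathPairs m id)) ⟩
  rows (pathPairs m id) ++ map (across zero) es ++ cols
    ≡⟨ cong (λ ps → rows ps ++ map (across zero) es ++ cols) (map-tabulate id _) ⟨
  edgesGP k adj (suc m) ∎
  where
  open PermutationReasoning
  es = edgesG k adj
  rows : List (Fin (suc m) × Fin (suc m)) → List (Edge k (Fin (suc m)))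
  rows ps = concatMap (λ i → map (λ p → along p i) ps) (allFin k)
  cols = concatMap (λ y → map (across y) es) (tabulate suc)

-- The run along the columns

AtColumn : ∀ {k C} → (Fin (k + k) → Fin k × C) → C → Set
AtColumn {k} t y = ∀ i → t (k ↑ʳ i) ≡ (i , y)

run-col : ∀ {k C} {t : Fin (k + k) → Fin k × C} {A y} → AtColumn t y → ∀ es →
  Run (t , A) (map (colOp y) es) (t , A)
run-col at []             = []
run-col at ((i , j) ∷ es) = link (at i) (at j) ∷ run-col at es

-- `unmoved` keeps a mark in place while later rows advance, and `bounded` ensures that the
-- following columns are still fresh.
record RowSwept {k : ℕ} {C : Set} (p : C × C) (is : List (Fin k)) (t : Fin (k + k) → Fin k × C) (A : List (Fin k × C)) : Set where
  field
    {t′}    : Fin (k + k) → Fin k × C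
    {A′}    : List (Fin k × C)
    run     : Run (t , A) (map (rowOp p) is) (t′ , A′)
    moved   : ∀ i → i ∈ is → t′ (k ↑ʳ i) ≡ (i , proj₂ p)
    unmoved : ∀ i → i ∉ is → t′ (k ↑ʳ i) ≡ t (k ↑ʳ i)
    first   : ∀ i → t′ (i ↑ˡ k) ≡ t (i ↑ˡ k)
    keeps   : ∀ {u} → u ∈ A → u ∈ A′
    covers  : ∀ i → i ∈ is → (i , proj₂ p) ∈ A′
    bounded : ∀ {u} → u ∈ A′ → u ∈ A ⊎ proj₂ u ≡ proj₂ p

run-row : ∀ {k C} (p : C × C) (is : List (Fin k)) → Unique is → ∀ t A →
  (∀ i → i ∈ is → t (k ↑ʳ i) ≡ (i , proj₁ p)) → (∀ i → i ∈ is → (i , proj₂ p) ∉ A) →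
  RowSwept p is t A
run-row p [] _ t A at fresh = record
  { run = [] ; moved = λ _ () ; unmoved = λ _ _ → refl ; first = λ _ → refl
  ; keeps = id ; covers = λ _ () ; bounded = inj₁ }
run-row {k} {C} p@(_ , y) (i ∷ is) (i∉is ∷ unique) t A at fresh = record
  { run     = advance (at i (here refl)) (fresh i (here refl)) ∷ R.run
  ; moved   = λ { j (here refl) → trans (R.unmoved i i∉) at-i ; j (there j∈) → R.moved j j∈ }
  ; unmoved = λ j j∉ → trans (R.unmoved j (j∉ ∘ there)) (off-i λ { refl → j∉ (here refl) })
  ; first   = λ j → trans (R.first j) (updateAt-minimal (j ↑ˡ k) (k ↑ʳ i) t (↑ˡ≢↑ʳ k j i))
  ; keeps   = R.keeps ∘ there
  ; covers  = λ { j (here refl) → R.keeps (here refl) ; j (there j∈) → R.covers j j∈ }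
  ; bounded = λ u∈ → [ (λ { (here refl) → inj₂ refl ; (there u∈A) → inj₁ u∈A }) , inj₂ ]′ (R.bounded u∈)
  }
  where
  t₁ : Fin (k + k) → Fin k × C
  t₁ = updateAt t (k ↑ʳ i) (const (i , y))

  i∉ : i ∉ is
  i∉ i∈ = All.lookup i∉is i∈ refl

  at-i : t₁ (k ↑ʳ i) ≡ (i , y)
  at-i = updateAt-updates (k ↑ʳ i) t

  off-i : ∀ {j} → j ≢ i → t₁ (k ↑ʳ j) ≡ t (k ↑ʳ j)
  off-i {j} j≢i = updateAt-minimal (k ↑ʳ j) (k ↑ʳ i) t (j≢i ∘ ↑ʳ-injective k j i)

  rest : RowSwept p is t₁ ((i , y) ∷ A)
  rest = run-row p is unique t₁ ((i , y) ∷ A)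
    (λ j j∈ → trans (off-i λ { refl → i∉ j∈ }) (at j (there j∈)))
    (λ { j j∈ (here refl) → i∉ j∈ ; j j∈ (there q) → fresh j (there j∈) q })

  module R = RowSwept rest

record Swept {k : ℕ} {C : Set} (es : List (Fin k × Fin k)) (m : ℕ) (c : Fin (suc m) → C)
             (t : Fin (k + k) → Fin k × C) (A : List (Fin k × C)) : Set where
  field
    {t′}   : Fin (k + k) → Fin k × C
    {A′}   : List (Fin k × C)
    run    : Run (t , A) (sweep es m c) (t′ , A′)
    last   : AtColumn t′ (c (fromℕ m))
    first  : ∀ i → t′ (i ↑ˡ k) ≡ t (i ↑ˡ k)
    keeps  : ∀ {u} → u ∈ A → u ∈ A′
    covers : ∀ i j → (i , c (suc j)) ∈ A′

run-sweep : ∀ {k C} (es : List (Fin k × Fin k)) m (c : Fin (suc m) → C) → (∀ {i j} → c i ≡ c j → i ≡ j) →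
  ∀ t A → AtColumn t (c zero) → (∀ i j → (i , c (suc j)) ∉ A) → Swept es m c t A
run-sweep es zero c c-inj t A at fresh = record
  { run = [] ; last = at ; first = λ _ → refl ; keeps = id ; covers = λ _ () }
run-sweep {k} es (suc m) c c-inj t A at fresh = record
  { run    = run-++ R.run (run-++ (run-col at′ es) S.run)
  ; last   = S.last
  ; first  = λ i → trans (S.first i) (R.first i)
  ; keeps  = S.keeps ∘ R.keeps
  ; covers = λ { i zero → S.keeps (R.covers i (∈-allFin i)) ; i (suc j) → S.covers i j }
  }
  where
  row-swept : RowSwept (c zero , c (suc zero)) (allFin k) t A
  row-swept = run-row (c zero , c (suc zero)) (allFin k) (Unique.allFin⁺ k) t A
    (λ i _ → at i) (λ i _ → fresh i zero)

  module R = RowSwept row-swept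

  at′ : AtColumn R.t′ (c (suc zero))
  at′ i = R.moved i (∈-allFin i)

  fresh′ : ∀ i j → (i , c (suc (suc j))) ∉ R.A′
  fresh′ i j q with R.bounded q
  ... | inj₁ q′ = fresh i (suc j) q′
  ... | inj₂ eq with c-inj eq
  ...   | ()

  module S = Swept (run-sweep es m (c ∘ suc) (suc-injective ∘ c-inj) R.t′ R.A′ at′ fresh′)

-- The column matrix and its start vector

module _ {k B : ℕ} (π : Fin B → Partition (k + k)) (complete : ∀ P → ∃ λ b → π b ≈P P) (es : List (Fin k × Fin k)) where

  private
    advances links : List (Op (k + k))
    advances = map advance (map (k ↑ʳ_) (allFin k))
    links    = map (λ e → link (k ↑ʳ proj₁ e) (k ↑ʳ proj₂ e)) es

  -- Advances precede links, so a virtual start has to undo the advances only; the first factor then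
  -- performs the links of the first column itself.
  columnMatrix : Matrix B
  columnMatrix = runMatrix π complete (advances ++ links)

  row : Fin (k + k) → Fin k
  row a = [ id , id ]′ (splitAt k a)

  row? : ∀ a b → Dec (row a ≡ row b)
  row? a b = row a ≟ row b

  row-equivalence : IsEquivalence (λ a b → row a ≡ row b)
  row-equivalence = record { refl = refl ; sym = sym ; trans = trans }

  -- In a single column the first and the current column coincide: marks `i` and `k + i` share a
  -- vertex, and without edges these pairs are the blocks.
  bareColumn : Fin B
  bareColumn = index π complete row? row-equivalence

  -- A virtual state of zero columns, from which the advances lead to bareColumn.
  startVector : Vector B
  startVector = undoAdvances π complete (map (k ↑ʳ_) (allFin k)) (point (just bareColumn))

  mulVec-startVector :
    mulVec columnMatrix startVector ≗ mulVec (runMatrix π complete links) (point (just bareColumn))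
  mulVec-startVector i = trans (runMatrix-++ π complete advances links startVector i)
    (mulVec-cong (runMatrix π complete links)
      (runMatrix-advances π complete (map (k ↑ʳ_) (allFin k)) (point (just bareColumn))) i)

  -- The operations never mention the columns, so each column contributes the same factor.
  sweep-matrix : ∀ {C : Set} m (c : Fin (suc m) → C) v →
    mulVec (runMatrix π complete (map proj₁ (sweep es m c))) v ≗ powVec columnMatrix m v
  sweep-matrix zero    c v i = mulVec-unit v i
  sweep-matrix (suc m) c v i = begin
    mulVec (R (map proj₁ (sweep es (suc m) c))) v i
      ≡⟨ cong (λ os → mulVec (R os) v i) ops≡ ⟩
    mulVec (R ((advances ++ links) ++ map proj₁ (sweep es m (c ∘ suc)))) v i
      ≡⟨ runMatrix-++ π complete (advances ++ links) _ v i ⟩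
    mulVec (R (map proj₁ (sweep es m (c ∘ suc)))) (mulVec columnMatrix v) i
      ≡⟨ sweep-matrix m (c ∘ suc) _ i ⟩
    powVec columnMatrix m (mulVec columnMatrix v) i
      ≡⟨ powVec-suc columnMatrix m v i ⟨
    powVec columnMatrix (suc m) v i ∎
    where
    open ≡-Reasoning
    R = runMatrix π complete
    rest = sweep es m (c ∘ suc)
    rs = map (rowOp (c zero , c (suc zero))) (allFin k)
    cs = map (colOp (c (suc zero))) es

    ops≡ : map proj₁ (sweep es (suc m) c) ≡ (advances ++ links) ++ map proj₁ rest
    ops≡ = begin
      map proj₁ (rs ++ cs ++ rest)                      ≡⟨ map-++ proj₁ rs (cs ++ rest) ⟩
      map proj₁ rs ++ map proj₁ (cs ++ rest)            ≡⟨ cong (map proj₁ rs ++_) (map-++ proj₁ cs rest) ⟩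
      map proj₁ rs ++ map proj₁ cs ++ map proj₁ rest
        ≡⟨ cong₂ (λ as ls → as ++ ls ++ map proj₁ rest)
             (trans (sym (map-∘ (allFin k))) (map-∘ (allFin k))) (sym (map-∘ es)) ⟩
      advances ++ links ++ map proj₁ rest               ≡⟨ ++-assoc advances links _ ⟨
      (advances ++ links) ++ map proj₁ rest             ∎

  -- The first column has links but no advances. `startVector` makes up for the missing advances,
  -- raising the exponent from `m` to `suc m`.
  fullSweep-matrix : ∀ {C : Set} m (c : Fin (suc m) → C) →
    mulVec (runMatrix π complete (map proj₁ (fullSweep es m c))) (point (just bareColumn)) ≗
    powVec columnMatrix (suc m) startVector
  fullSweep-matrix m c i = begin
    mulVec (R (map proj₁ (fullSweep es m c))) (point (just bareColumn)) i
      ≡⟨ cong (λ os → mulVec (R os) (point (just bareColumn)) i)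
           (trans (map-++ proj₁ (map (colOp (c zero)) es) _)
             (cong (_++ map proj₁ (sweep es m c)) (sym (map-∘ es)))) ⟩
    mulVec (R (links ++ map proj₁ (sweep es m c))) (point (just bareColumn)) i
      ≡⟨ runMatrix-++ π complete links _ _ i ⟩
    mulVec (R (map proj₁ (sweep es m c))) (mulVec (R links) (point (just bareColumn))) i
      ≡⟨ sweep-matrix m c _ i ⟩
    powVec columnMatrix m (mulVec (R links) (point (just bareColumn))) i
      ≡⟨ powVec-cong m mulVec-startVector i ⟨
    powVec columnMatrix m (mulVec columnMatrix startVector) i
      ≡⟨ powVec-suc columnMatrix m startVector i ⟨
    powVec columnMatrix (suc m) startVector i ∎
    where
    open ≡-Reasoning
    R = runMatrix π complete

    powVec-cong : ∀ n {v w} → v ≗ w → powVec columnMatrix n v ≗ powVec columnMatrix n w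
    powVec-cong zero    v≗w = v≗w
    powVec-cong (suc n) v≗w = mulVec-cong columnMatrix (powVec-cong n v≗w)

  path-[] : {V : Set} {u v : V} → Path [] u v → u ≡ v
  path-[] here               = refl
  path-[] (step (inj₁ ()) _)
  path-[] (step (inj₂ ()) _)

  startConfig : {C : Set} → C → Config (k + k) (Fin k × C)
  startConfig y = (λ a → row a , y) , map (_, y) (allFin k)

  start-supported : {C : Set} (y : C) → Supported (startConfig y) []
  start-supported y = (λ ()) , λ a → ∈-map⁺ (_, y) (∈-allFin (row a))

  start-describes : {C : Set} (y : C) → Describes π complete (startConfig y) [] (just bareColumn)
  start-describes y =
    (λ _ _ _ p → contradiction (↭-sym p) ¬x∷xs↭[]) ,
    (λ a b p → subst (Path [] (row a , y) ∘ (_, y)) (index⁻ π complete row? row-equivalence p) here) ,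
    (λ a b p → index⁺ π complete row? row-equivalence (cong proj₁ (path-[] p))) ,
    λ u u∈ → alive u (∈-map⁻ (_, y) u∈)
    where
    alive : ∀ u → (∃ λ i → i ∈ allFin k × u ≡ (i , y)) → ∃ λ a → Path [] u (row a , y)
    alive _ (i , _ , refl) = i ↑ˡ k ,
      subst (Path [] (i , y) ∘ (_, y)) (sym (cong [ id , id ]′ (splitAt-↑ˡ k i k))) here

-- Completing forests by wrap edges

_≟V_ : ∀ {k n} → DecidableEquality (Fin k × Fin n)
_≟V_ = ≡-dec _≟_ _≟_

allV? : ∀ {k n} {P : Fin k × Fin n → Set} → (∀ u → Dec (P u)) → Dec (∀ u → P u)
allV? P? with all? (λ i → all? λ j → P? (i , j))
... | yes p = yes λ (i , j) → p i j
... | no ¬p = no λ p → ¬p λ i j → p (i , j)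

isTree? : ∀ {k n} (l : List (Edge k (Fin n))) → Dec (IsTree l)
isTree? l = (allV? λ u → allV? λ v → path? _≟V_ l u v) ×-dec cycleFree? _≟V_ l

-- Follow the path up to its first edge from `S`: it is entered at a marked vertex, and everything
-- before it lies in `F`.
path-++-marked : {V W : Set} {t : W → V} {F S : List (V × V)} →
  (∀ {x y} → (x , y) ∈ S → (∃ λ a → x ≡ t a) × (∃ λ b → y ≡ t b)) →
  ∀ {u v} → Path (F ++ S) u v → Path F u v ⊎ ∃ λ a → Path F u (t a)
path-++-marked {t = t} {F} {S} marked = go
  where
  prepend : ∀ {u w v} → Path F u w → Path F w v ⊎ (∃ λ a → Path F w (t a)) → Path F u v ⊎ ∃ λ a → Path F u (t a)
  prepend p (inj₁ q)       = inj₁ (conn-trans p q)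
  prepend p (inj₂ (a , q)) = inj₂ (a , conn-trans p q)

  go : ∀ {u v} → Path (F ++ S) u v → Path F u v ⊎ ∃ λ a → Path F u (t a)
  go here = inj₁ here
  go (step (inj₁ e) p) with ∈-++⁻ F e
  ... | inj₁ e∈F = prepend (path-edge e∈F) (go p)
  ... | inj₂ e∈S with marked e∈S
  ...   | (a , refl) , _ = inj₂ (a , here)
  go (step (inj₂ e) p) with ∈-++⁻ F e
  ... | inj₁ e∈F = prepend (conn-sym (path-edge e∈F)) (go p)
  ... | inj₂ e∈S with marked e∈S
  ...   | _ , (b , refl) = inj₂ (b , here)

hasCount-spanningTrees : ∀ {k n} (es : List (Edge k (Fin n))) →
  Σ ℕ λ c → HasCount (IsSpanningTree es) c × + c ≡ sumPicks es (indicator ∘ isTree?)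
hasCount-spanningTrees es with hasCount-pick es isTree?
... | c , hc , c≡ = c , hasCount-cong (isTree⇒spanningTree es) (spanningTree⇒isTree es) hc , c≡

module _ (k : ℕ) (adj : Fin k → Fin k → Bool) (m : ℕ) (h : 3 ≤ suc m) where

  private
    n = suc m
    GP = edgesGP k adj n
    GC = edgesGC k adj n h
    wrap = edgesWrap k n (three≤⇒pos h)
    w = wVert k n (three≤⇒pos h)

  -- Agrees with `d` on forests but makes sense for every list of edges, so it can be summed over
  -- all choices.
  completions : List (Edge k (Fin n)) → ℤ
  completions F = sumPicks wrap λ S → indicator (isTree? (F ++ S))

  completions-↭ : ∀ {F F′} → F ↭ F′ → completions F ≡ completions F′
  completions-↭ p = sumPicks-cong wrap λ s → indicator-cong (isTree? _) (isTree? _)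
    (isTree-↭ (++⁺ʳ (pick wrap s) p)) (isTree-↭ (++⁺ʳ (pick wrap s) (↭-sym p)))

  wrap-length : k ≡ length wrap
  wrap-length = sym (length-tabulate _)

  hasCount-completions : ∀ s {F} → F ↭ pick GP s → Σ ℕ λ c →
    HasCount (λ S → IsSpanningTree GC (unionEdges k adj n h s S)) c × + c ≡ completions F
  hasCount-completions s {F} p with hasCount-pick-cast wrap wrap-length (λ l → isTree? (F ++ l))
  ... | c , hc , c≡ = c , hasCount-cong to from hc , c≡
    where
    union : ∀ S → pick GC (unionEdges k adj n h s S) ≡ pick GP s ++ pick wrap (cast wrap-length S)
    union S = pick-++ GP wrap _ wrap-length s S

    to : ∀ S → IsTree (F ++ pick wrap (cast wrap-length S)) → IsSpanningTree GC (unionEdges k adj n h s S)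
    to S T = isTree⇒spanningTree GC (unionEdges k adj n h s S)
      (subst IsTree (sym (union S)) (isTree-↭ (++⁺ʳ _ p) T))

    from : ∀ S → IsSpanningTree GC (unionEdges k adj n h s S) → IsTree (F ++ pick wrap (cast wrap-length S))
    from S T = isTree-↭ (++⁺ʳ _ (↭-sym p))
      (subst IsTree (union S) (spanningTree⇒isTree GC (unionEdges k adj n h s S) T))

  module _ {B : ℕ} (π : Fin B → Partition (k + k)) (complete : ∀ P → ∃ λ b → π b ≈P P)
           (d : Fin B → ℕ) (d-counts : IsTreeCountingVector k adj π d)
           {t : Fin (k + k) → Fin k × Fin n} {A : List (Fin k × Fin n)}
           (t≡w : ∀ a → t a ≡ w a) (all-active : ∀ u → u ∈ A) where

    wrap-marked : ∀ s {x y} → (x , y) ∈ pick wrap s → (∃ λ a → x ≡ t a) × (∃ λ b → y ≡ t b)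
    wrap-marked s e∈ with pick⊆ wrap s e∈
    ... | i , _ , wi≡ with ∈-tabulate⁻ (subst (_∈ wrap) wi≡ (∈-lookup i))
    ...   | j , refl = (j ↑ˡ k , sym (trans (t≡w _) w-first)) , (k ↑ʳ j , sym (trans (t≡w _) w-last))
      where
      w-first : w (j ↑ˡ k) ≡ (j , firstCol n (three≤⇒pos h))
      w-first rewrite splitAt-↑ˡ k j k = refl

      w-last : w (k ↑ʳ j) ≡ (j , lastCol n (three≤⇒pos h))
      w-last rewrite splitAt-↑ʳ k k j = refl

    -- A cycle survives further edges, and a vertex joined to no mark stays apart because wrap edges
    -- have marked ends.
    completions-dead : ∀ {F} → Describes π complete (t , A) F nothing → completions F ≡ 0ℤ
    completions-dead {F} D = sumPicks-zero wrap λ s → indicator-no (isTree? _) (no-tree s D)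
      where
      no-tree : ∀ s → Describes π complete (t , A) F nothing → ¬ IsTree (F ++ pick wrap s)
      no-tree s (inj₁ cyc) (_ , cf) = cyc (cycleFree-++ˡ cf)
      no-tree s (inj₂ ((i , j) , _ , dead)) (conn , _)
        -- Row `i` of the lost vertex provides a mark to aim for, there being no default mark when
        -- `k` may be zero.
        with path-++-marked {t = t} {F} (wrap-marked s) (conn (i , j) (t (i ↑ˡ k)))
      ... | inj₁ p       = dead (i ↑ˡ k) p
      ... | inj₂ (a , p) = dead a p

    -- Every vertex is active by now and so joined to a mark; hence representatives of the blocks
    -- meet each tree exactly once, and the two numbers agree.
    cylConsistent : ∀ s {F β} → F ↭ pick GP s → Describes π complete (t , A) F (just β) →
      CylConsistent k adj n h s (π β)
    cylConsistent s {F} {β} p (cf , S⇒P , P⇒S , alive) with numBlocks (π β)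
    ... | c , r , r-inj , r-cov =
      (c , (r , r-inj , r-cov) , t ∘ r ,
        (λ a b q → r-inj a b (P⇒S (r a) (r b) (from q))) , cover) ,
      λ a b → (λ q → subst₂ (Conn (Sel GP s)) (t≡w a) (t≡w b) (to (S⇒P a b q))) ,
              (λ q → P⇒S a b (from (subst₂ (Conn (Sel GP s)) (sym (t≡w a)) (sym (t≡w b)) q)))
      where
      to : ∀ {u v} → Path F u v → Conn (Sel GP s) u v
      to q = path⇒sel GP s (path-↭ p q)

      from : ∀ {u v} → Conn (Sel GP s) u v → Path F u v
      from q = path-↭ (↭-sym p) (sel⇒path GP s q)

      cover : ∀ u → ∃ λ a → Conn (Sel GP s) u (t (r a))
      cover u with alive u (all-active u)
      ... | x , q with r-cov x
      ...   | a , x~ra = a , to (conn-trans q (S⇒P x (r a) x~ra))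

    completions-value : ∀ s {F} q → F ↭ pick GP s → Describes π complete (t , A) F q →
      completions F ≡ dot (point q) d
    completions-value s nothing  p D = trans (completions-dead D) (sym (dot-point nothing d))
    completions-value s {F} (just β) p D with hasCount-completions s p
    ... | c , hc , c≡ = begin
      completions F         ≡⟨ c≡ ⟨
      + c                   ≡⟨ cong +_ (hasCount-unique hc (d-counts β n h s forest (cylConsistent s p D))) ⟩
      + d β                 ≡⟨ dot-point (just β) d ⟨
      dot (point (just β)) d ∎
      where
      open ≡-Reasoning
      forest : IsForest GP s
      forest = cycleFree⇒acyclic GP s (cycleFree-↭ p (proj₁ D))

  -- A set of edges of `G × Cₙ` is a set in `G × Pₙ` together with a set of wrap edges. Summing over
  -- the latter first leaves `completions`, which the sweep evaluates.
  sum-completions : ∀ {B} (π : Fin B → Partition (k + k)) (complete : ∀ P → ∃ λ b → π b ≈P P)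
    (d : Fin B → ℕ) → IsTreeCountingVector k adj π d →
    sumPicks GC (indicator ∘ isTree?) ≡
    dot (powVec (columnMatrix π complete (edgesG k adj)) n (startVector π complete (edgesG k adj))) d
  sum-completions π complete d d-counts = begin
    sumPicks GC (indicator ∘ isTree?)
      ≡⟨ sumPicks-++ GP wrap (indicator ∘ isTree?) ⟩
    sumPicks GP completions
      ≡⟨ sumPicks-↭ completions-↭ edges↭ ⟨
    sumPicks (map proj₂ os) completions
      ≡⟨ sumPicks-cong (map proj₂ os) (λ s → cong completions (sym (++-identityʳ (pick (map proj₂ os) s)))) ⟩
    sumPicks (map proj₂ os) (λ l → completions (l ++ []))
      ≡⟨ transfer π complete completions-↭ d run final (just b₀)
           (start-supported π complete es zero) (start-describes π complete es zero) ⟩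
    dot (mulVec (runMatrix π complete (map proj₁ os)) (point (just b₀))) d
      ≡⟨ dot-cong d (fullSweep-matrix π complete es m id) ⟩
    dot (powVec (columnMatrix π complete es) n (startVector π complete es)) d ∎
    where
    open ≡-Reasoning
    es = edgesG k adj
    os = fullSweep es m id
    b₀ = bareColumn π complete es
    edges↭ = fullSweep-edges k adj m
    t₀ = Config.mark (startConfig π complete es zero)
    A₀ = Config.active (startConfig π complete es zero)

    at₀ : AtColumn t₀ zero
    at₀ i = cong (λ x → [ id , id ]′ x , zero) (splitAt-↑ʳ k k i)

    fresh₀ : ∀ i j → (i , suc j) ∉ A₀
    fresh₀ i j q with ∈-map⁻ (_, zero) q
    ... | _ , _ , ()

    module S = Swept (run-sweep es m id id t₀ A₀ at₀ fresh₀)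

    run : Run (t₀ , A₀) os (S.t′ , S.A′)
    run = run-++ (run-col at₀ es) S.run

    -- `firstCol` computes to `zero` and `lastCol` to `fromℕ m`, the columns where the two halves of
    -- the frontier end up.
    t′≡w : ∀ a → S.t′ a ≡ w a
    t′≡w a with splitAt k a in eq
    ... | inj₁ i rewrite sym (splitAt⁻¹-↑ˡ {k} {k} eq) =
      trans (S.first i) (cong (λ x → [ id , id ]′ x , zero) (splitAt-↑ˡ k i k))
    ... | inj₂ i rewrite sym (splitAt⁻¹-↑ʳ {k} {k} eq) = S.last i

    all-active : ∀ u → u ∈ S.A′
    all-active (i , zero)  = S.keeps (∈-map⁺ (_, zero) (∈-allFin i))
    all-active (i , suc j) = S.covers i j

    final : ∀ s {F} q → F ↭ pick (map proj₂ os) s ++ [] → Supported (S.t′ , S.A′) F →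
      Describes π complete (S.t′ , S.A′) F q → completions F ≡ dot (point q) d
    final s q p _ D with pick-↭ edges↭ s
    ... | s′ , p′ = completions-value π complete d d-counts t′≡w all-active s′ q
      (↭-trans p (↭-trans (↭-reflexive (++-identityʳ _)) p′)) D

theorem3 : (k : ℕ) (adj : Fin k → Fin k → Bool) →
    (∀ i j → adj i j ≡ adj j i) → (∀ i → adj i i ≡ false) →
    (B : ℕ) (π : Fin B → Partition (k + k)) →
    (∀ b b′ → π b ≈P π b′ → b ≡ b′) → (∀ (P : Partition (k + k)) → ∃ λ b → π b ≈P P) →
    Σ (Fin B → Fin B → ℤ) λ M → Σ (Fin B → ℤ) λ v →
    (d : Fin B → ℕ) → IsTreeCountingVector k adj π d →
    (n : ℕ) (h : 3 ≤ n) →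
    Σ ℕ λ c → HasCount (λ (T : Subset (length (edgesGC k adj n h))) → IsSpanningTree (edgesGC k adj n h) T) c
    × (+ c ≡ dot (powVec M n v) d)
theorem3 k adj _ _ B π _ complete =
  columnMatrix π complete (edgesG k adj) , startVector π complete (edgesG k adj) , λ
  -- `h` excludes `n = 0`, so there is a first column to start from.
  { d d-counts (suc m) h → let c , hc , c≡ = hasCount-spanningTrees (edgesGC k adj (suc m) h)
                           in c , hc , trans c≡ (sum-completions k adj m h π complete d d-counts) }
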